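{- There exists an absolute constant $c>0$ such that the following holds for every field $\mathbb{F}$ and every sufficiently large positive integer $n$: every fan-in $2$ noncommutative arithmetic circuit over $\mathbb{F}$ computing $\mathrm{Pal}_{n,n}(X,Y)$ has size at least $c\,n^2$. In other words, every such circuit has size $\Omega(n^2)$.
   Context: Let $\mathbb{F}$ be a field, and let $X=\{x_1,\dots,x_n\}$ and $Y=\{y_1,\dots,y_n\}$ be disjoint sets of noncommuting variables; $\mathbb{F}\langle X,Y\rangle$ is the free (noncommutative) polynomial ring. The palindrome polynomial is $$\mathrm{Pal}_{n,n}(X,Y)=\sum_{(i_1,\dots,i_n)\in[n]^n}\Bigl(\prod_{j=1}^n x_{i_j}\Bigr)\Bigl(\prod_{j=1}^n y_{i_{n+1-j}}\Bigr)=\sum_{(i_1,\dots,i_n)\in[n]^n} x_{i_1}x_{i_2}\cdots x_{i_n}\,y_{i_n}\cdots y_{i_2}y_{i_1}.$$ A fan-in $2$ noncommutative arithmetic circuit is a directed acyclic graph whose leaves are labeled by field constants or variables from $X\cup Y$, and whose internal nodes (gates) are labeled by $+$ or $\times$; every internal node has in-degree exactly $2$, and each $\times$ gate has a designated left and right child. Edges may be labeled by field constants, which scale the polynomial carried along the edge. Each gate computes a noncommutative polynomial in the natural way (a $\times$ gate computes (left input)$\cdot$(right input)). The circuit computes $f$ if some gate computes $f$. The size of the circuit is the total number of vertices of the graph. -}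

module Defs where

open import Level using (Level; _⊔_; Setω) renaming (suc to lsuc)
open import Algebra.Bundles using (CommutativeRing)
open import Data.Nat using (ℕ; zero; suc)
open import Data.Fin using (Fin; zero; suc)
open import Data.List using (List; []; _∷_; map; foldr; concatMap; reverse; _++_)
open import Data.List.Base using (allFin)
open import Data.Vec as Vec using (Vec; []; _∷_)
open import Data.Sum using (_⊎_; inj₁; inj₂)
open import Data.Product using (_×_; _,_; Σ; ∃)
open import Relation.Nullary using (¬_)

record Field (c ℓ : Level) : Set (lsuc (c ⊔ ℓ)) where
  field
    commutativeRing : CommutativeRing c ℓ
  open CommutativeRing commutativeRing public
  field
    1≉0     : ¬ (1# ≈ 0#)
    inverse : ∀ x → ¬ (x ≈ 0#) → Σ Carrier λ y → (x * y) ≈ 1#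

Var : ℕ → Set
Var n = Fin n ⊎ Fin n

xv : ∀ {n} → Fin n → Var n
xv = inj₁

yv : ∀ {n} → Fin n → Var n
yv = inj₂

Word : ℕ → Set
Word n = List (Var n)

splits : ∀ {A : Set} → List A → List (List A × List A)
splits []       = ([] , []) ∷ []
splits (a ∷ w)  = ([] , a ∷ w) ∷ map (λ { (u , v) → (a ∷ u , v) }) (splits w)

-- Noncommutative polynomials over F in variables X ∪ Y, represented by
-- their coefficient function (finitely supported in practice).

module Poly {c ℓ} (F : Field c ℓ) (n : ℕ) where
  open Field F using (Carrier; _≈_; _+_; _*_; 0#; 1#)

  Pol : Set c
  Pol = Word n → Carrier

  _≋_ : Pol → Pol → Set ℓ
  f ≋ g = ∀ w → f w ≈ g w

  constP : Carrier → Pol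
  constP a []      = a
  constP a (_ ∷ _) = 0#

  0P 1P : Pol
  0P = constP 0#
  1P = constP 1#

  varP : Var n → Pol
  varP v (u ∷ []) with v | u
  ... | inj₁ i | inj₁ j with i Data.Fin.≟ j
  ...   | Relation.Nullary.yes _ = 1#
  ...   | Relation.Nullary.no  _ = 0#
  varP v (u ∷ []) | inj₁ i | inj₂ j = 0#
  varP v (u ∷ []) | inj₂ i | inj₁ j = 0#
  varP v (u ∷ []) | inj₂ i | inj₂ j with i Data.Fin.≟ j
  ...   | Relation.Nullary.yes _ = 1#
  ...   | Relation.Nullary.no  _ = 0#
  varP v []            = 0#
  varP v (_ ∷ _ ∷ _)   = 0#

  scaleP : Carrier → Pol → Pol
  scaleP a f w = a * f w

  _+P_ : Pol → Pol → Pol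
  (f +P g) w = f w + g w

  _*P_ : Pol → Pol → Pol
  (f *P g) w = foldr (λ { (u , v) acc → (f u * g v) + acc }) 0# (splits w)

  sumP : List Pol → Pol
  sumP = foldr _+P_ 0P

  prodP : List Pol → Pol
  prodP = foldr _*P_ 1P

  tuples : ∀ k → List (Vec (Fin n) k)
  tuples zero    = [] ∷ []
  tuples (suc k) = concatMap (λ i → map (i ∷_) (tuples k)) (allFin n)

  Pal : Pol
  Pal = sumP (map (λ is → prodP (map (λ i → varP (xv i)) (Vec.toList is)
                                  ++ map (λ i → varP (yv i)) (reverse (Vec.toList is))))
                  (tuples n))

-- Fan-in 2 noncommutative arithmetic circuits, as topologically ordered
-- lists of vertices.  A vertex may only refer to earlier vertices (so the
-- graph is a DAG).  Leaves are labelled by a field constant or a variable;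
-- internal gates are + or × with exactly two (ordered: left, right) inputs,
-- each incoming edge carrying a field constant scaling the input.

module Circ {c ℓ} (F : Field c ℓ) (n : ℕ) where
  open Field F using (Carrier; _≈_; _+_; _*_; 0#; 1#)
  open Poly F n

  data Vertex (k : ℕ) : Set c where
    leafConst : Carrier → Vertex k
    leafVar   : Var n → Vertex k
    plusGate  : (a : Carrier) (l : Fin k) (b : Carrier) (r : Fin k) → Vertex k
    timesGate : (a : Carrier) (l : Fin k) (b : Carrier) (r : Fin k) → Vertex k

  data Circuit : ℕ → Set c where
    []  : Circuit zero
    _▷_ : ∀ {k} → Circuit k → Vertex k → Circuit (suc k)

  evalVertex : ∀ {k} → (Fin k → Pol) → Vertex k → Pol
  evalVertex ρ (leafConst a)       = constP a
  evalVertex ρ (leafVar v)         = varP v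
  evalVertex ρ (plusGate a l b r)  = scaleP a (ρ l) +P scaleP b (ρ r)
  evalVertex ρ (timesGate a l b r) = scaleP a (ρ l) *P scaleP b (ρ r)

  -- polynomial computed at each vertex (index 0 = last added vertex)
  eval : ∀ {s} → Circuit s → Fin s → Pol
  eval (C ▷ v) zero    = evalVertex (eval C) v
  eval (C ▷ v) (suc i) = eval C i

  Computes : ∀ {s} → Circuit s → Pol → Set ℓ
  Computes {s} C f = Σ (Fin s) λ i → eval C i ≋ f

  size : ∀ {s} → Circuit s → ℕ
  size {s} _ = s

-- Existential over ℕ with a body in Setω (for quantifying over fields of
-- all universe levels).

record Σℕω (P : ℕ → Setω) : Setω where
  constructor _,ω_
  field
    witness : ℕ
    proof   : P witness

-- Split the vertices, counted from the output downwards, into n chunks of at most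
-- K ≤ n / 16 vertices.  There are tensors T and R on [n]ⁿ with ⟨T , R⟩ = 1 such
-- that, for every product gate g · h of chunk t and every interval (p , e] of
-- positions with p ≤ t < e, contracting T with the coefficients of g on x-words
-- along (p , e] gives 0, and so does contracting R with those of h on y-words.
-- They are built one position at a time by a Golod–Shafarevich style count: a pair
-- of dual bases of size 2 ^ e grows to size n 2 ^ e, and each linear condition
-- lowers the size by one.  Only the slices of the previous dual bases have to be
-- tested, so there are at most 8 K 2 ^ e conditions at that step.
--
-- Contract the coefficients of a gate of chunk t on words x_{p+1} … x_n y_n … y_{q+1},
-- where p , q ≤ t, with T and R.  The result is 0, by induction along the circuit:
-- in a product, a cut beyond position t is killed by T or R, and for any other cut
-- one of the factors is again contracted from positions at most t.  For the output
-- with p = q = 0 this contradicts that Pal contracts to ⟨T , R⟩ = 1.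
--
-- Equality in the field is not decidable, so T and R exist only up to double
-- negation, which suffices for a contradiction.

module Submission where

open import Defs
open import Level using (Level; _⊔_)
open import Data.Fin as Fin using (Fin; zero; suc; toℕ; fromℕ<; punchIn; combine; remQuot; _↑ˡ_)
import Data.Fin.Properties as Fin
open import Data.List.Base using (List; []; _∷_; _∷ʳ_; _++_; map; foldr; concatMap; reverse; length; tabulate; allFin)
import Data.List.Properties as List
open import Data.Nat as ℕ using (ℕ; zero; suc; _≤_; _<_; s≤s; z≤n; _^_)
import Data.Nat.Properties as ℕ
import Data.Nat.DivMod as ℕ
open import Data.Nat.Tactic.RingSolver using (solve-∀)
open import Data.Product using (Σ; _×_; _,_; proj₁; proj₂; ∃)
open import Data.Sum using (_⊎_; inj₁; inj₂; [_,_]′)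
open import Data.Vec.Base as Vec using (Vec; []; _∷_)
import Data.Vec.Properties as Vec
open import Function.Base using (_∘_; id)
open import Relation.Binary.PropositionalEquality as ≡ using (_≡_; _≢_)
open import Relation.Nullary using (¬_; yes; no; contradiction)
open import Relation.Nullary.Negation using (¬¬-map)
open import Relation.Nullary.Decidable using (¬¬-excluded-middle)

-- Case distinctions under double negation.

¬¬-bind : ∀ {a b} {A : Set a} {B : Set b} → ¬ ¬ A → (A → ¬ ¬ B) → ¬ ¬ B
¬¬-bind a f k = a (λ x → f x k)

¬¬-all⊎∃¬ : ∀ {p} {m} (P : Fin m → Set p) → ¬ ¬ ((∀ a → P a) ⊎ ∃ λ a → ¬ P a)
¬¬-all⊎∃¬ {m = zero}  P k = k (inj₁ λ ())
¬¬-all⊎∃¬ {m = suc m} P k = ¬¬-excluded-middle λ where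
  (no ¬p) → k (inj₂ (zero , ¬p))
  (yes p) → ¬¬-all⊎∃¬ (P ∘ suc) λ where
    (inj₁ ps)       → k (inj₁ λ { zero → p ; (suc a) → ps a })
    (inj₂ (a , ¬q)) → k (inj₂ (suc a , ¬q))

-- Sums over words of a fixed length.

module WordSums {c ℓ} (F : Field c ℓ) (n : ℕ) where
  open Field F hiding (zero; _≉_)
  import Algebra.Properties.Semiring.Sum semiring as Sum
  open import Relation.Binary.Reasoning.Setoid setoid

  Wd : Set
  Wd = List (Fin n)

  -- Tensors of every order share this type. The order enters only through the length of the words
  -- summed over, so slicing and extending need no casts.
  Fun : Set c
  Fun = Wd → Carrier

  _≐_ : Fun → Fun → Set ℓ
  x ≐ y = ∀ w → x w ≈ y w

  δ : ∀ {m} → Fin m → Fin m → Carrier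
  δ zero    zero    = 1#
  δ zero    (suc _) = 0#
  δ (suc _) zero    = 0#
  δ (suc i) (suc j) = δ i j

  δ-refl : ∀ {m} (i : Fin m) → δ i i ≡ 1#
  δ-refl zero    = ≡.refl
  δ-refl (suc i) = δ-refl i

  δ-≢ : ∀ {m} {i j : Fin m} → i ≢ j → δ i j ≡ 0#
  δ-≢ {i = zero}  {zero}  i≢j = contradiction ≡.refl i≢j
  δ-≢ {i = zero}  {suc _} i≢j = ≡.refl
  δ-≢ {i = suc _} {zero}  i≢j = ≡.refl
  δ-≢ {i = suc i} {suc j} i≢j = δ-≢ (i≢j ∘ ≡.cong suc)

  δ-sym : ∀ {m} (i j : Fin m) → δ i j ≡ δ j i
  δ-sym zero    zero    = ≡.refl
  δ-sym zero    (suc j) = ≡.refl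
  δ-sym (suc i) zero    = ≡.refl
  δ-sym (suc i) (suc j) = δ-sym i j

  δ-punchIn : ∀ {m} (a : Fin (suc m)) b d → δ (punchIn a b) (punchIn a d) ≡ δ b d
  δ-punchIn zero    b       d       = ≡.refl
  δ-punchIn (suc a) zero    zero    = ≡.refl
  δ-punchIn (suc a) zero    (suc d) = ≡.refl
  δ-punchIn (suc a) (suc b) zero    = ≡.refl
  δ-punchIn (suc a) (suc b) (suc d) = δ-punchIn a b d

  -- Opaque, so that unification does not try to invert foldr on unsolved summands.
  opaque
    sum : ∀ {m} → (Fin m → Carrier) → Carrier
    sum = Sum.sum

    sum-cong : ∀ {m} {f g : Fin m → Carrier} → (∀ i → f i ≈ g i) → sum f ≈ sum g
    sum-cong = Sum.sum-cong-≋

    sum-[] : (f : Fin 0 → Carrier) → sum f ≡ 0#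
    sum-[] f = ≡.refl

    sum-∷ : ∀ {m} (f : Fin (suc m) → Carrier) → sum f ≡ f zero + sum (f ∘ suc)
    sum-∷ f = ≡.refl

    sum-*ˡ : ∀ {m} a (f : Fin m → Carrier) → sum (λ i → a * f i) ≈ a * sum f
    sum-*ˡ a f = sym (Sum.*-distribˡ-sum a f)

    sum-*ʳ : ∀ {m} a (f : Fin m → Carrier) → sum (λ i → f i * a) ≈ sum f * a
    sum-*ʳ a f = sym (Sum.*-distribʳ-sum a f)

    sum-+ : ∀ {m} (f g : Fin m → Carrier) → sum (λ i → f i + g i) ≈ sum f + sum g
    sum-+ = Sum.∑-distrib-+

    sum-comm : ∀ {m k} (f : Fin m → Fin k → Carrier) →
               sum (λ i → sum λ j → f i j) ≈ sum (λ j → sum λ i → f i j)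
    sum-comm = Sum.∑-comm

    sum-zero : ∀ {m} {f : Fin m → Carrier} → (∀ i → f i ≈ 0#) → sum f ≈ 0#
    sum-zero {m} f≈0 = trans (sum-cong f≈0) (Sum.sum-replicate-zero m)

  δ-↑ˡ : ∀ {m} d (i j : Fin m) → δ (i ↑ˡ d) (j ↑ˡ d) ≡ δ i j
  δ-↑ˡ d zero    zero    = ≡.refl
  δ-↑ˡ d zero    (suc j) = ≡.refl
  δ-↑ˡ d (suc i) zero    = ≡.refl
  δ-↑ˡ d (suc i) (suc j) = δ-↑ˡ d i j

  sum-δ : ∀ {m} (i : Fin m) (f : Fin m → Carrier) → sum (λ j → δ i j * f j) ≈ f i
  sum-δ zero    f = begin
    sum (λ j → δ zero j * f j)               ≈⟨ reflexive (sum-∷ _) ⟩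
    1# * f zero + sum (λ j → 0# * f (suc j)) ≈⟨ +-cong (*-identityˡ _) (sum-zero λ _ → zeroˡ _) ⟩
    f zero + 0#                              ≈⟨ +-identityʳ _ ⟩
    f zero                                   ∎
  sum-δ (suc i) f = begin
    sum (λ j → δ (suc i) j * f j)               ≈⟨ reflexive (sum-∷ _) ⟩
    0# * f zero + sum (λ j → δ i j * f (suc j)) ≈⟨ +-cong (zeroˡ _) (sum-δ i (f ∘ suc)) ⟩
    0# + f (suc i)                              ≈⟨ +-identityˡ _ ⟩
    f (suc i)                                   ∎

  sumW : ℕ → Fun → Carrier
  sumW zero    φ = φ []
  sumW (suc m) φ = sum λ i → sumW m (φ ∘ (i ∷_))

  sumW-cong′ : ∀ m {φ ψ} → (∀ w → length w ≡ m → φ w ≈ ψ w) → sumW m φ ≈ sumW m ψ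
  sumW-cong′ zero    eq = eq [] ≡.refl
  sumW-cong′ (suc m) eq = sum-cong λ i → sumW-cong′ m λ w |w| → eq (i ∷ w) (≡.cong suc |w|)

  sumW-cong : ∀ m {φ ψ} → φ ≐ ψ → sumW m φ ≈ sumW m ψ
  sumW-cong m eq = sumW-cong′ m λ w _ → eq w

  sumW-zero′ : ∀ m {φ} → (∀ w → length w ≡ m → φ w ≈ 0#) → sumW m φ ≈ 0#
  sumW-zero′ zero    eq = eq [] ≡.refl
  sumW-zero′ (suc m) eq = sum-zero λ i → sumW-zero′ m λ w |w| → eq (i ∷ w) (≡.cong suc |w|)

  sumW-zero : ∀ m {φ} → (∀ w → φ w ≈ 0#) → sumW m φ ≈ 0#
  sumW-zero m eq = sumW-zero′ m λ w _ → eq w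

  sumW-+ : ∀ m φ ψ → sumW m (λ w → φ w + ψ w) ≈ sumW m φ + sumW m ψ
  sumW-+ zero    φ ψ = refl
  sumW-+ (suc m) φ ψ = trans (sum-cong λ i → sumW-+ m _ _) (sum-+ _ _)

  sumW-*ˡ : ∀ m a φ → sumW m (λ w → a * φ w) ≈ a * sumW m φ
  sumW-*ˡ zero    a φ = refl
  sumW-*ˡ (suc m) a φ = trans (sum-cong λ i → sumW-*ˡ m a _) (sum-*ˡ a _)

  sumW-*ʳ : ∀ m a φ → sumW m (λ w → φ w * a) ≈ sumW m φ * a
  sumW-*ʳ zero    a φ = refl
  sumW-*ʳ (suc m) a φ = trans (sum-cong λ i → sumW-*ʳ m a _) (sum-*ʳ a _)

  sumW-sum : ∀ m {k} (f : Fin k → Fun) → sumW m (λ w → sum λ i → f i w) ≈ sum λ i → sumW m (f i)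
  sumW-sum zero    f = refl
  sumW-sum (suc m) f = trans (sum-cong λ j → sumW-sum m _) (sum-comm _)

  sumW-comm : ∀ a b (f : Wd → Fun) →
              sumW a (λ u → sumW b (f u)) ≈ sumW b (λ v → sumW a (λ u → f u v))
  sumW-comm zero    b f = refl
  sumW-comm (suc a) b f = trans (sum-cong λ i → sumW-comm a b _) (sym (sumW-sum b _))

  sumW-∷ʳ : ∀ m φ → sumW (suc m) φ ≈ sumW m (λ w → sum λ i → φ (w ∷ʳ i))
  sumW-∷ʳ zero    φ = refl
  sumW-∷ʳ (suc m) φ = sum-cong λ i → sumW-∷ʳ m (φ ∘ (i ∷_))

  sumW-reverse : ∀ m φ → sumW m (φ ∘ reverse) ≈ sumW m φ
  sumW-reverse zero    φ = refl
  sumW-reverse (suc m) φ = begin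
    sum (λ i → sumW m (λ w → φ (reverse (i ∷ w))))
      ≈⟨ (sum-cong λ i → sumW-cong m λ w → reflexive (≡.cong φ (List.unfold-reverse i w))) ⟩
    sum (λ i → sumW m (λ w → φ (reverse w ∷ʳ i)))
      ≈⟨ (sum-cong λ i → sumW-reverse m (λ w → φ (w ∷ʳ i))) ⟩
    sum (λ i → sumW m (λ w → φ (w ∷ʳ i)))
      ≈⟨ sumW-sum m _ ⟨
    sumW m (λ w → sum λ i → φ (w ∷ʳ i))
      ≈⟨ sumW-∷ʳ m φ ⟨
    sumW (suc m) φ ∎

-- Subspaces of tensors and dual systems.

module DualSystems {c ℓ} (F : Field c ℓ) (n : ℕ) where
  open Field F hiding (zero; _≉_)
  open WordSums F n
  open import Algebra.Properties.Ring ring using (-‿distribˡ-*)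
  open import Relation.Binary.Reasoning.Setoid setoid
  open import Algebra.Solver.Ring.NaturalCoefficients.Default commutativeSemiring

  record Subspace {u} (U : Fun → Set u) : Set (c ⊔ ℓ ⊔ u) where
    field
      ∈-resp  : ∀ {x y} → x ≐ y → U x → U y
      ∈-zero  : U (λ _ → 0#)
      ∈-add   : ∀ {x y} → U x → U y → U (λ w → x w + y w)
      ∈-scale : ∀ a {x} → U x → U (λ w → a * x w)
  open Subspace

  record Linear (φ : Fun → Carrier) : Set (c ⊔ ℓ) where
    field
      cong  : ∀ {x y} → x ≐ y → φ x ≈ φ y
      add   : ∀ x y → φ (λ w → x w + y w) ≈ φ x + φ y
      scale : ∀ a x → φ (λ w → a * x w) ≈ a * φ x

  ker-subspace : ∀ {φ} → Linear φ → Subspace (λ x → φ x ≈ 0#)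
  ker-subspace {φ} L = record
    { ∈-resp  = λ eq x∈ → trans (sym (cong eq)) x∈
    ; ∈-zero  = begin
        φ (λ _ → 0#)      ≈⟨ cong (λ _ → sym (zeroˡ 0#)) ⟩
        φ (λ _ → 0# * 0#) ≈⟨ scale 0# (λ _ → 0#) ⟩
        0# * φ (λ _ → 0#) ≈⟨ zeroˡ _ ⟩
        0#                ∎
    ; ∈-add   = λ {x} {y} x∈ y∈ → trans (add x y) (trans (+-cong x∈ y∈) (+-identityˡ 0#))
    ; ∈-scale = λ a {x} x∈ → trans (scale a x) (trans (*-congˡ x∈) (zeroʳ a))
    }
    where open Linear L

  ∀-subspace : ∀ {i u} {I : Set i} {U : I → Fun → Set u} →
               (∀ j → Subspace (U j)) → Subspace (λ x → ∀ j → U j x)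
  ∀-subspace sU = record
    { ∈-resp  = λ eq x∈ j → ∈-resp (sU j) eq (x∈ j)
    ; ∈-zero  = λ j → ∈-zero (sU j)
    ; ∈-add   = λ x∈ y∈ j → ∈-add (sU j) (x∈ j) (y∈ j)
    ; ∈-scale = λ a x∈ j → ∈-scale (sU j) a (x∈ j)
    }

  preimage-subspace : ∀ {u} {U : Fun → Set u} (g : Wd → Wd) → Subspace U → Subspace (λ x → U (x ∘ g))
  preimage-subspace {U = U} g sU = record
    { ∈-resp  = λ {x} {y} eq → ∈-resp {U = U} sU {x ∘ g} {y ∘ g} (eq ∘ g)
    ; ∈-zero  = ∈-zero {U = U} sU
    ; ∈-add   = λ {x} {y} → ∈-add {U = U} sU {x ∘ g} {y ∘ g}
    ; ∈-scale = λ a {x} → ∈-scale {U = U} sU a {x ∘ g}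
    }

  -- An inductive closure instead of coefficient vectors: inclusion in a subspace is a plain
  -- recursion, and coordinates are recovered by `expand`.
  data Span {r} (α : Fin r → Fun) : Fun → Set (c ⊔ ℓ) where
    gen    : ∀ a → Span α (α a)
    resp   : ∀ {x y} → x ≐ y → Span α x → Span α y
    zero∈  : Span α (λ _ → 0#)
    add∈   : ∀ {x y} → Span α x → Span α y → Span α (λ w → x w + y w)
    scale∈ : ∀ a {x} → Span α x → Span α (λ w → a * x w)

  Span-subspace : ∀ {r} (α : Fin r → Fun) → Subspace (Span α)
  Span-subspace α = record { ∈-resp = resp ; ∈-zero = zero∈ ; ∈-add = add∈ ; ∈-scale = scale∈ }

  Span⊆ : ∀ {u r} {U : Fun → Set u} {α : Fin r → Fun} →
          Subspace U → (∀ a → U (α a)) → ∀ {x} → Span α x → U x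
  Span⊆ sU α∈ (gen a)      = α∈ a
  Span⊆ sU α∈ (resp eq s)  = ∈-resp sU eq (Span⊆ sU α∈ s)
  Span⊆ sU α∈ zero∈        = ∈-zero sU
  Span⊆ sU α∈ (add∈ s t)   = ∈-add sU (Span⊆ sU α∈ s) (Span⊆ sU α∈ t)
  Span⊆ sU α∈ (scale∈ a s) = ∈-scale sU a (Span⊆ sU α∈ s)

  sum∈ : ∀ {u m} {U : Fun → Set u} → Subspace U → {f : Fin m → Fun} →
         (∀ i → U (f i)) → U (λ w → sum λ i → f i w)
  sum∈ {m = zero}  sU f∈ = ∈-resp sU (λ w → reflexive (≡.sym (sum-[] _))) (∈-zero sU)
  sum∈ {m = suc m} sU f∈ =
    ∈-resp sU (λ w → reflexive (≡.sym (sum-∷ _))) (∈-add sU (f∈ zero) (sum∈ sU (f∈ ∘ suc)))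

  sumW∈ : ∀ {u} {U : Fun → Set u} → Subspace U → ∀ m {f : Wd → Fun} →
          (∀ v → length v ≡ m → U (f v)) → U (λ w → sumW m λ v → f v w)
  sumW∈ sU zero    f∈ = f∈ [] ≡.refl
  sumW∈ sU (suc m) f∈ = sum∈ sU λ i → sumW∈ sU m λ v |v| → f∈ (i ∷ v) (≡.cong suc |v|)

  ⟨_,_⟩[_] : Fun → Fun → ℕ → Carrier
  ⟨ x , y ⟩[ e ] = sumW e λ w → x w * y w

  ⟨,⟩-comm : ∀ e x y → ⟨ x , y ⟩[ e ] ≈ ⟨ y , x ⟩[ e ]
  ⟨,⟩-comm e x y = sumW-cong e λ w → *-comm (x w) (y w)

  ⟨,⟩-linear : ∀ e y → Linear (λ x → ⟨ x , y ⟩[ e ])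
  ⟨,⟩-linear e y = record
    { cong  = λ eq → sumW-cong e λ w → *-congʳ (eq w)
    ; add   = λ x x′ → trans (sumW-cong e λ w → distribʳ (y w) (x w) (x′ w)) (sumW-+ e _ _)
    ; scale = λ a x → trans (sumW-cong e λ w → *-assoc a (x w) (y w)) (sumW-*ˡ e a _)
    }

  -- Biorthogonality stands in for linear independence of both families and supplies coordinates
  -- without deciding equality.
  record Sys (e r : ℕ) : Set (c ⊔ ℓ) where
    field
      α β  : Fin r → Fun
      dual : ∀ a b → ⟨ α a , β b ⟩[ e ] ≈ δ a b
  open Sys

  swap : ∀ {e r} → Sys e r → Sys e r
  swap {e} S = record
    { α = β S ; β = α S
    ; dual = λ a b → trans (⟨,⟩-comm e (β S a) (α S b)) (trans (dual S b a) (reflexive (δ-sym b a))) }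

  _⊑_ : ∀ {e r r′} → Sys e r → Sys e r′ → Set (c ⊔ ℓ)
  S ⊑ S′ = (∀ a → Span (α S′) (α S a)) × (∀ a → Span (β S′) (β S a))

  ⊑-refl : ∀ {e r} (S : Sys e r) → S ⊑ S
  ⊑-refl S = gen , gen

  ⊑-trans : ∀ {e r r′ r″} {S : Sys e r} {S′ : Sys e r′} {S″ : Sys e r″} →
            S ⊑ S′ → S′ ⊑ S″ → S ⊑ S″
  ⊑-trans (p , q) (p′ , q′) =
    (λ a → Span⊆ (Span-subspace _) p′ (p a)) , (λ a → Span⊆ (Span-subspace _) q′ (q a))

  restrict : ∀ {e r r′} (S : Sys e r) (f : Fin r′ → Fin r) → (∀ a b → δ (f a) (f b) ≡ δ a b) →
             Σ (Sys e r′) (_⊑ S)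
  restrict S f δf = record
    { α = α S ∘ f ; β = β S ∘ f
    ; dual = λ a b → trans (dual S (f a) (f b)) (reflexive (δf a b)) } , gen ∘ f , gen ∘ f

  resize : ∀ {e r r′} → r ≡ r′ → (S : Sys e r) → Σ (Sys e r′) (_⊑ S)
  resize ≡.refl S = S , ⊑-refl S

  -- Both sides are linear in `x`, and on a generator `dual` turns the coordinates into `δ`.
  expand : ∀ {e r} (S : Sys e r) {x} → Span (α S) x →
           ∀ w → x w ≈ sum λ b → ⟨ x , β S b ⟩[ e ] * α S b w
  expand {e} S = Span⊆ (record
    { ∈-resp  = λ eq x∈ w → trans (sym (eq w)) (trans (x∈ w) (sum-cong λ b → *-congʳ (L.cong b eq)))
    ; ∈-zero  = λ w → sym (sum-zero λ b → trans (*-congʳ (∈-zero (ker-subspace (⟨,⟩-linear e _)))) (zeroˡ _))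
    ; ∈-add   = λ x∈ y∈ w → trans (+-cong (x∈ w) (y∈ w)) (trans (sym (sum-+ _ _))
                  (sum-cong λ b → trans (sym (distribʳ _ _ _)) (*-congʳ (sym (L.add b _ _)))))
    ; ∈-scale = λ a x∈ w → trans (*-congˡ (x∈ w)) (trans (sym (sum-*ˡ a _))
                  (sum-cong λ b → trans (sym (*-assoc _ _ _)) (*-congʳ (sym (L.scale b _ _)))))
    })
    (λ a w → trans (sym (sum-δ a (λ b → α S b w))) (sum-cong λ b → *-congʳ (sym (dual S a b))))
    where module L b = Linear (⟨,⟩-linear e (β S b))

  -- The pairing reads only words of length `e`, yet `x` vanishes on all words, because `expand`
  -- holds on every word.
  detect : ∀ {e r} (S : Sys e r) {x} → Span (α S) x → (∀ b → ⟨ x , β S b ⟩[ e ] ≈ 0#) → ∀ w → x w ≈ 0#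
  detect S s eq w = trans (expand S s w) (sum-zero λ b → trans (*-congʳ (eq b)) (zeroˡ _))

  -- Eliminating with the vector at index a costs that vector and its dual partner only.
  pivot : ∀ {e r φ} → Linear φ → (S : Sys e (suc r)) → (a : Fin (suc r)) → ¬ φ (α S a) ≈ 0# →
          Σ (Sys e r) λ S′ → S′ ⊑ S × (∀ b → φ (α S′ b) ≈ 0#)
  pivot {e} {r} {φ} L S a φa≉0 = record
    { α    = α′
    ; β    = β S ∘ punchIn a
    ; dual = λ b d → begin
        ⟨ α′ b , β S (punchIn a d) ⟩[ e ]
          ≈⟨ ⟨⟩.add d _ _ ⟩
        ⟨ α S (punchIn a b) , β S (punchIn a d) ⟩[ e ] + ⟨ (λ w → k b * α S a w) , β S (punchIn a d) ⟩[ e ]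
          ≈⟨ +-cong (dual S _ _) (trans (⟨⟩.scale d (k b) _) (*-congˡ (dual S _ _))) ⟩
        δ (punchIn a b) (punchIn a d) + k b * δ a (punchIn a d)
          -- The remaining β vectors are orthogonal to `α S a`, so adding multiples of it leaves
          -- their pairings unchanged and the β side needs no correction.
          ≈⟨ +-cong (reflexive (δ-punchIn a b d)) (trans (*-congˡ (reflexive (δ-≢ (Fin.punchInᵢ≢i a d ∘ ≡.sym)))) (zeroʳ _)) ⟩
        δ b d + 0#
          ≈⟨ +-identityʳ _ ⟩
        δ b d ∎
    }
    , ((λ b → add∈ (gen _) (scale∈ (k b) (gen a))) , gen ∘ punchIn a)
    , λ b → begin
        φ (α′ b)                                        ≈⟨ add _ _ ⟩
        φ (α S (punchIn a b)) + φ (λ w → k b * α S a w) ≈⟨ +-congˡ (scale (k b) _) ⟩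
        l b + - (l b * y) * φa                          ≈⟨ +-congˡ (-‿distribˡ-* _ _) ⟨
        l b + - (l b * y * φa)                          ≈⟨ +-congˡ (-‿cong (trans (*-assoc _ _ _) (*-congˡ (trans (*-comm y φa) φa*y≈1)))) ⟩
        l b + - (l b * 1#)                              ≈⟨ +-congˡ (-‿cong (*-identityʳ _)) ⟩
        l b + - l b                                     ≈⟨ -‿inverseʳ _ ⟩
        0# ∎
    where
    open Linear L
    module ⟨⟩ d = Linear (⟨,⟩-linear e (β S (punchIn a d)))
    φa = φ (α S a)
    y = proj₁ (inverse φa φa≉0)
    φa*y≈1 = proj₂ (inverse φa φa≉0)
    l k : Fin r → Carrier
    l b = φ (α S (punchIn a b))
    k b = - (l b * y)
    α′ : Fin r → Fun
    α′ b w = α S (punchIn a b) w + k b * α S a w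

  -- `k` is the price, in dual pairs, of bringing the α side into `V`. The remaining size is
  -- arbitrary, so that cuts compose.
  Cut : ∀ {u v} → ℕ → (Fun → Set u) → ℕ → (Fun → Set v) → Set (c ⊔ ℓ ⊔ u ⊔ v)
  Cut e U k V = ∀ {r} (S : Sys e (k ℕ.+ r)) → (∀ a → U (α S a)) →
                ¬ ¬ (Σ (Sys e r) λ S′ → S′ ⊑ S × (∀ a → V (α S′ a)))

  cut-map : ∀ {u v v′ e k} {U : Fun → Set u} {V : Fun → Set v} {V′ : Fun → Set v′} → Subspace U →
            (∀ {x} → U x → V x → V′ x) → Cut e U k V → Cut e U k V′
  cut-map sU f C S S∈U = ¬¬-map
    (λ (S′ , S′⊑S , S′∈V) → S′ , S′⊑S , λ a → f (Span⊆ sU S∈U (proj₁ S′⊑S a)) (S′∈V a)) (C S S∈U)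

  cut-ker : ∀ {u e φ} {U : Fun → Set u} → Linear φ → Cut e U 1 (λ x → φ x ≈ 0#)
  cut-ker {φ = φ} L S _ = ¬¬-map
    -- If `φ` vanishes on every α vector, a pair is dropped all the same, so that the size falls by
    -- one in both cases.
    (λ { (inj₁ φ≈0) → let S′ , S′⊑S = restrict S suc (λ a b → ≡.refl) in S′ , S′⊑S , φ≈0 ∘ suc
       ; (inj₂ (a , φa≉0)) → pivot L S a φa≉0 })
    (¬¬-all⊎∃¬ (λ a → φ (α S a) ≈ 0#))

  -- The second cut only forms combinations of vectors already in the subspace `V`, so the first
  -- condition survives and the prices add up.
  cut-∩ : ∀ {u v v′ e k k′} {U : Fun → Set u} {V : Fun → Set v} {V′ : Fun → Set v′} →
          Subspace U → Subspace V → Cut e U k V → Cut e U k′ V′ → Cut e U (k ℕ.+ k′) (λ x → V x × V′ x)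
  cut-∩ {e = e} {k} {k′} sU sV C C′ {r} S S∈U
    rewrite ℕ.+-assoc k k′ r =
    ¬¬-bind (C S S∈U) λ (S₁ , S₁⊑S , S₁∈V) →
    ¬¬-map (λ (S₂ , S₂⊑S₁ , S₂∈V′) →
        S₂ , ⊑-trans {S = S₂} {S₁} {S} S₂⊑S₁ S₁⊑S , λ a → Span⊆ sV S₁∈V (proj₁ S₂⊑S₁ a) , S₂∈V′ a)
      (C′ S₁ (λ a → Span⊆ sU S∈U (proj₁ S₁⊑S a)))

  cut-∀ : ∀ {u v e k m} {U : Fun → Set u} {V : Fin m → Fun → Set v} →
          Subspace U → (∀ i → Subspace (V i)) → (∀ i → Cut e U k (V i)) →
          Cut e U (m ℕ.* k) (λ x → ∀ i → V i x)
  cut-∀ {m = zero}  sU sV C S _ k = k (S , ⊑-refl S , λ _ ())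
  cut-∀ {m = suc m} {U} {V} sU sV C =
    cut-map {U = U} {λ x → V zero x × V′ x} {λ x → ∀ i → V i x} sU
      (λ _ (v , vs) → λ { zero → v ; (suc i) → vs i })
      (cut-∩ {U = U} {V zero} {V′} sU (sV zero) (C zero) (cut-∀ {U = U} {V ∘ suc} sU (sV ∘ suc) (C ∘ suc)))
    where
    V′ : Fun → Set _
    V′ x = ∀ i → V (suc i) x

  -- Extension of a dual system by one position.

  ext₁ : Fin n → Fun → Fun
  ext₁ i x []      = 0#
  ext₁ i x (j ∷ w) = δ i j * x w

  extα : ∀ {r} → (Fin r → Fun) → Fin (n ℕ.* r) → Fun
  extα {r} α b = ext₁ (proj₁ (remQuot {n} r b)) (α (proj₂ (remQuot {n} r b)))

  ⟨ext₁,ext₁⟩ : ∀ e i j x y → ⟨ ext₁ i x , ext₁ j y ⟩[ suc e ] ≈ δ i j * ⟨ x , y ⟩[ e ]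
  ⟨ext₁,ext₁⟩ e i j x y = begin
    sum (λ k → sumW e λ w → δ i k * x w * (δ j k * y w))
      ≈⟨ (sum-cong λ k → trans
           (sumW-cong e λ w → solve 4 (λ p q r s → p :* q :* (r :* s) := p :* r :* (q :* s)) refl (δ i k) (x w) (δ j k) (y w))
           (sumW-*ˡ e (δ i k * δ j k) _)) ⟩
    sum (λ k → δ i k * δ j k * ⟨ x , y ⟩[ e ]) ≈⟨ sum-*ʳ ⟨ x , y ⟩[ e ] (λ k → δ i k * δ j k) ⟩
    sum (λ k → δ i k * δ j k) * ⟨ x , y ⟩[ e ] ≈⟨ *-congʳ (sum-δ i (δ j)) ⟩
    δ j i * ⟨ x , y ⟩[ e ]                     ≈⟨ *-congʳ (reflexive (δ-sym j i)) ⟩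
    δ i j * ⟨ x , y ⟩[ e ]                     ∎

  δ-remQuot : ∀ {r} (a b : Fin (n ℕ.* r)) →
    δ (proj₁ (remQuot {n} r a)) (proj₁ (remQuot {n} r b)) * δ (proj₂ (remQuot {n} r a)) (proj₂ (remQuot {n} r b)) ≈ δ a b
  δ-remQuot {r} a b with a Fin.≟ b
  ... | yes ≡.refl = begin
    _             ≈⟨ *-cong (reflexive (δ-refl (proj₁ (remQuot {n} r a)))) (reflexive (δ-refl (proj₂ (remQuot {n} r a)))) ⟩
    1# * 1#       ≈⟨ *-identityˡ 1# ⟩
    1#            ≈⟨ reflexive (δ-refl a) ⟨
    δ a a         ∎
  ... | no a≢b with proj₁ (remQuot {n} r a) Fin.≟ proj₁ (remQuot {n} r b) | proj₂ (remQuot {n} r a) Fin.≟ proj₂ (remQuot {n} r b)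
  ...   | no ≢₁  | _     = trans (*-congʳ (reflexive (δ-≢ ≢₁))) (trans (zeroˡ _) (reflexive (≡.sym (δ-≢ a≢b))))
  ...   | yes _  | no ≢₂ = trans (*-congˡ (reflexive (δ-≢ ≢₂))) (trans (zeroʳ _) (reflexive (≡.sym (δ-≢ a≢b))))
  ...   | yes ≡₁ | yes ≡₂ = contradiction
    (≡.trans (≡.sym (Fin.combine-remQuot {n} r a)) (≡.trans (≡.cong₂ combine ≡₁ ≡₂) (Fin.combine-remQuot {n} r b))) a≢b

  -- The tensor product of the standard basis at the new position, which is its own dual, with the
  -- old system.
  ext : ∀ {e r} → Sys e r → Sys (suc e) (n ℕ.* r)
  ext {e} {r} S = record
    { α = extα (α S) ; β = extα (β S)
    ; dual = λ a b → trans (⟨ext₁,ext₁⟩ e (proj₁ (remQuot r a)) (proj₁ (remQuot r b)) _ _)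
                     (trans (*-congˡ (dual S (proj₂ (remQuot {n} r a)) (proj₂ (remQuot {n} r b)))) (δ-remQuot a b)) }

  extα-slice : ∀ {r} (α : Fin r → Fun) b j → Span α (extα α b ∘ (j ∷_))
  extα-slice α b j = scale∈ _ (gen _)

-- Tensors killed by the factors of all product gates.

module Tower {c ℓ} (F : Field c ℓ) (n K : ℕ) where
  open Field F hiding (zero; _≉_)
  open WordSums F n
  open DualSystems F n
  open Subspace
  open Sys

  -- Words list positions from the highest down, as `ext₁` reads the new one first. On `p + m`
  -- positions this contracts along (p , p + m].
  contract : Fun → ℕ → Fun → Fun
  contract g m x w = sumW m λ v → g v * x (v ++ w)

  contract-linear : ∀ g m w → Linear (λ x → contract g m x w)
  contract-linear g m w = record
    { cong  = λ eq → sumW-cong m λ v → *-congˡ (eq (v ++ w))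
    ; add   = λ x y → trans (sumW-cong m λ v → distribˡ (g v) _ _) (sumW-+ m _ _)
    ; scale = λ a x → trans (sumW-cong m λ v → trans (sym (*-assoc _ _ _)) (trans (*-congʳ (*-comm _ _)) (*-assoc _ _ _))) (sumW-*ˡ m a _)
    }

  ⟨contract⟩-linear : ∀ g m e y → Linear (λ x → ⟨ contract g m x , y ⟩[ e ])
  ⟨contract⟩-linear g m e y = record
    { cong  = λ eq → P.cong λ w → C.cong w eq
    ; add   = λ x x′ → trans (P.cong λ w → C.add w x x′) (P.add _ _)
    ; scale = λ a x → trans (P.cong λ w → C.scale w a x) (P.scale a _)
    }
    where
    module P = Linear (⟨,⟩-linear e y)
    module C w = Linear (contract-linear g m w)

  Slices : ∀ {u} → (Fun → Set u) → ℕ → Fun → Set u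
  Slices U m x = ∀ z → length z ≡ m → U (λ w → x (z ++ w))

  Slices-subspace : ∀ {u} {U : Fun → Set u} m → Subspace U → Subspace (Slices U m)
  Slices-subspace {U = U} m sU = ∀-subspace λ z → ∀-subspace λ _ → preimage-subspace {U = U} (z ++_) sU

  -- A contraction is a linear combination of slices, so it stays in the span of an earlier dual
  -- basis.
  contract∈ : ∀ {u} {U : Fun → Set u} → Subspace U → ∀ g m x → Slices U m x → U (contract g m x)
  contract∈ sU g m x x∈ = sumW∈ sU m λ v |v| → ∈-scale sU (g v) (x∈ v |v|)

  Gates : Set c
  Gates = ℕ → Fin K → Fun

  Kills : Gates → ℕ → Fun → Set ℓ
  Kills G e x = ∀ p m t k → p ℕ.+ m ≡ e → p ≤ t → t < e → ∀ w → contract (G t k) m x w ≈ 0#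

  -- Fixing the highest positions by `z` accounts for the intervals that end below `e`.
  AllKills : Gates → ℕ → Fun → Set ℓ
  AllKills G e x = ∀ z e′ → length z ℕ.+ e′ ≡ e → Kills G e′ (λ w → x (z ++ w))

  -- The intervals (p , E] are treated one start `p` at a time; `KillsFrom` is the single start p =
  -- e.
  KillsUpTo : Gates → ℕ → ℕ → Fun → Set ℓ
  KillsUpTo G e E x = ∀ p m t k → p ≤ e → p ℕ.+ m ≡ E → p ≤ t → t < E → ∀ w → contract (G t k) m x w ≈ 0#

  KillsFrom : Gates → ℕ → ℕ → Fun → Set ℓ
  KillsFrom G e m x = ∀ (t : Fin m) k w → contract (G (e ℕ.+ toℕ t) k) m x w ≈ 0#

  contract-subspace : ∀ g m w → Subspace (λ x → contract g m x w ≈ 0#)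
  contract-subspace g m w = ker-subspace (contract-linear g m w)

  Kills-subspace : ∀ G e → Subspace (Kills G e)
  Kills-subspace G e =
    ∀-subspace λ p → ∀-subspace λ m → ∀-subspace λ t → ∀-subspace λ k →
    ∀-subspace λ _ → ∀-subspace λ _ → ∀-subspace λ _ → ∀-subspace λ w → contract-subspace (G t k) m w

  KillsUpTo-subspace : ∀ G e E → Subspace (KillsUpTo G e E)
  KillsUpTo-subspace G e E =
    ∀-subspace λ p → ∀-subspace λ m → ∀-subspace λ t → ∀-subspace λ k →
    ∀-subspace λ _ → ∀-subspace λ _ → ∀-subspace λ _ → ∀-subspace λ _ → ∀-subspace λ w → contract-subspace (G t k) m w

  KillsFrom-subspace : ∀ G e m → Subspace (KillsFrom G e m)
  KillsFrom-subspace G e m =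
    ∀-subspace λ t → ∀-subspace λ k → ∀-subspace λ w → contract-subspace (G (e ℕ.+ toℕ t) k) m w

  AllKills-subspace : ∀ G e → Subspace (AllKills G e)
  AllKills-subspace G e =
    ∀-subspace λ z → ∀-subspace λ e′ → ∀-subspace λ _ →
    preimage-subspace {U = Kills G e′} (z ++_) (Kills-subspace G e′)

  -- By `contract∈` each contraction lies in the span of `α S`, where by `detect` its `r` pairings
  -- with `β S` decide whether it vanishes. Each gate thus costs `r` conditions, however many words
  -- `w` there are.
  cut-from : ∀ G {e r} (S : Sys e r) m E →
             Cut E (Slices (Span (α S)) m) (m ℕ.* (K ℕ.* (r ℕ.* 1))) (KillsFrom G e m)
  cut-from G {e} {r} S m E =
    cut-map {U = U} {λ x → ∀ t k b → V t k b x} {KillsFrom G e m} sU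
      (λ {x} x∈ x⊥ t k → detect S (contract∈ (Span-subspace (α S)) (G (e ℕ.+ toℕ t) k) m x x∈) (x⊥ t k))
      (cut-∀ {U = U} {λ t x → ∀ k b → V t k b x} sU (λ t → ∀-subspace λ k → ∀-subspace λ b → sV t k b) λ t →
       cut-∀ {U = U} {λ k x → ∀ b → V t k b x} sU (λ k → ∀-subspace λ b → sV t k b) λ k →
       cut-∀ {U = U} {λ b x → V t k b x} sU (λ b → sV t k b) λ b →
       cut-ker {U = U} (linear t k b))
    where
    U : Fun → Set _
    U = Slices (Span (α S)) m
    sU : Subspace U
    sU = Slices-subspace m (Span-subspace (α S))
    V : Fin m → Fin K → Fin r → Fun → Set _
    V t k b x = ⟨ contract (G (e ℕ.+ toℕ t) k) m x , β S b ⟩[ e ] ≈ 0#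
    linear : ∀ t k b → Linear _
    linear t k b = ⟨contract⟩-linear (G (e ℕ.+ toℕ t) k) m e (β S b)
    sV : ∀ t k b → Subspace (V t k b)
    sV t k b = ker-subspace (linear t k b)

  KillsFrom⇒Kills : ∀ G e m x → KillsFrom G e m x → ∀ {m′} → e ℕ.+ m′ ≡ e ℕ.+ m →
                    ∀ t k → e ≤ t → t < e ℕ.+ m → ∀ w → contract (G t k) m′ x w ≈ 0#
  KillsFrom⇒Kills G e m x x⊥ {m′} eq t k e≤t t<e+m w
    with ≡.refl ← ℕ.+-cancelˡ-≡ e m′ m eq
    with d , ≡.refl ← ℕ.m≤n⇒∃[o]m+o≡n e≤t
    with d<m ← ℕ.+-cancelˡ-< e d m t<e+m =
    ≡.subst (λ d′ → contract (G (e ℕ.+ d′) k) m x w ≈ 0#) (Fin.toℕ-fromℕ< d<m) (x⊥ (fromℕ< d<m) k w)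

  -- For each p ≤ e: the chunks t with p ≤ t < e + m, the K gates in each, and the
  -- 2 ^ p functionals that detect whether a vector in the span at level p vanishes.
  cnt : ℕ → ℕ → ℕ
  cnt zero    m = m ℕ.* (K ℕ.* (1 ℕ.* 1))
  cnt (suc e) m = m ℕ.* (K ℕ.* (2 ^ suc e ℕ.* 1)) ℕ.+ cnt e (suc m)

  -- `cuts` stands for the dual bases of all levels up to `e`: it provides the cut they jointly pay
  -- for when `m` positions are still to come, so the earlier systems need not be stored.
  record Stage (G : Gates) e (S : Sys e (2 ^ e)) : Set (c ⊔ ℓ) where
    field
      kills : ∀ a → AllKills G e (α S a)
      cuts  : ∀ m → Cut (e ℕ.+ m) (Slices (Span (α S)) m) (cnt e m) (KillsUpTo G e (e ℕ.+ m))
  open Stage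

  S₀ : Sys 0 1
  S₀ = record { α = λ _ _ → 1# ; β = λ _ _ → 1# ; dual = λ { zero zero → *-identityˡ 1# } }

  stage₀ : ∀ G (S : Sys 0 1) → Stage G 0 S
  stage₀ G S = record
    { kills = λ { _ [] .0 ≡.refl p m t k _ _ () }
    ; cuts  = λ m → cut-map {U = Slices (Span (α S)) m} {KillsFrom G 0 m} {KillsUpTo G 0 m}
                      (Slices-subspace m (Span-subspace (α S)))
                      (λ { {x} _ x⊥ .0 m′ t k z≤n eq 0≤t t<m → KillsFrom⇒Kills G 0 m x x⊥ eq t k 0≤t t<m })
                      (cut-from G S m m)
    }

  next : ∀ {G e S} → Stage G e S → (S′ : Sys (suc e) (2 ^ suc e)) →
         (∀ a → Span (extα (α S)) (α S′ a)) → (∀ a → KillsUpTo G e (suc e) (α S′ a)) → Stage G (suc e) S′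
  next {G} {e} {S} st S′ S′⊑ S′⊥ = record
    { kills = λ where
        -- An interval ending at the new position has p ≤ t < suc e, so p ≤ e. If a letter is fixed
        -- there, the slice lies in `Span (α S)` and the previous stage applies.
        a []      .(suc e) ≡.refl p m t k eq p≤t t<e → S′⊥ a p m t k (ℕ.≤-pred (ℕ.≤-<-trans p≤t t<e)) eq p≤t t<e
        a (j ∷ z) e′ eq → Span⊆ (AllKills-subspace G e) (kills st) (slice∈ j (gen a)) z e′ (ℕ.suc-injective eq)
    ; cuts = λ m → cut-map {U = U m} {λ x → KillsFrom G (suc e) m x × KillsUpTo G e (suc e ℕ.+ m) x}
        {KillsUpTo G (suc e) (suc e ℕ.+ m)} (sU m)
        (λ { {x} _ (x⊥ , x⊥′) p m′ t k p≤1+e eq p≤t t<E → case-≤ m x x⊥ x⊥′ p m′ t k (ℕ.m≤n⇒m<n∨m≡n p≤1+e) eq p≤t t<E })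
        -- The start p = suc e is tested against the new system; earlier starts are left to the
        -- previous stage, for which `suc m` positions are to come.
        (cut-∩ {U = U m} {KillsFrom G (suc e) m} {KillsUpTo G e (suc e ℕ.+ m)} (sU m) (KillsFrom-subspace G (suc e) m)
          (cut-from G S′ m (suc e ℕ.+ m))
          λ S″ S″∈U → ≡.subst (λ E → Cut E (Slices (Span (α S)) (suc m)) (cnt e (suc m)) (KillsUpTo G e E))
            (ℕ.+-suc e m) (cuts st (suc m)) S″ (λ a → slices m (α S″ a) (S″∈U a)))
    }
    where
    U : ℕ → Fun → Set _
    U m = Slices (Span (α S′)) m
    sU : ∀ m → Subspace (U m)
    sU m = Slices-subspace m (Span-subspace (α S′))
    slice∈ : ∀ j {x} → Span (α S′) x → Span (α S) (x ∘ (j ∷_))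
    slice∈ j = Span⊆ (preimage-subspace {U = Span (α S)} (j ∷_) (Span-subspace (α S))) λ a →
      Span⊆ (preimage-subspace {U = Span (α S)} (j ∷_) (Span-subspace (α S))) (λ b → extα-slice (α S) b j) (S′⊑ a)
    slices : ∀ m x → U m x → Slices (Span (α S)) (suc m) x
    slices m       x x∈ (j ∷ []) eq with ≡.refl ← eq = slice∈ j {x} (x∈ [] ≡.refl)
    slices (suc m) x x∈ (i ∷ j ∷ z) eq = slices m (x ∘ (i ∷_)) (λ z′ eq′ → x∈ (i ∷ z′) (≡.cong suc eq′)) (j ∷ z) (ℕ.suc-injective eq)
    case-≤ : ∀ m x → KillsFrom G (suc e) m x → KillsUpTo G e (suc e ℕ.+ m) x →
             ∀ p m′ t k → p < suc e ⊎ p ≡ suc e → p ℕ.+ m′ ≡ suc e ℕ.+ m → p ≤ t → t < suc e ℕ.+ m →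
             ∀ w → contract (G t k) m′ x w ≈ 0#
    case-≤ m x x⊥ x⊥′ p m′ t k (inj₁ p≤e) eq = x⊥′ p m′ t k (ℕ.≤-pred p≤e) eq
    case-≤ m x x⊥ x⊥′ p m′ t k (inj₂ ≡.refl) eq = KillsFrom⇒Kills G (suc e) m x x⊥ eq t k

  cut-next : ∀ {G e S} → Stage G e S →
             Cut (suc e) (Slices (Span (α S)) 1) (cnt e 1) (KillsUpTo G e (suc e))
  cut-next {G} {e} {S} st = ≡.subst
    (λ E → Cut E (Slices (Span (α S)) 1) (cnt e 1) (KillsUpTo G e E)) (ℕ.+-comm e 1) (cuts st 1)

  -- `cnt e m` is the sum of K 2 ^ p (e + m - p) over p ≤ e, essentially geometric; the factor 2 m +
  -- 2 is reproduced exactly by the recursion. At m = 1 the bound is 4 K 2 ^ e.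
  cnt-bound : ∀ e m → cnt e m ≤ K ℕ.* (2 ^ e ℕ.* (2 ℕ.* m ℕ.+ 2))
  cnt-bound zero    m = ℕ.≤-trans (ℕ.≤-reflexive (identity m K))
    (ℕ.*-monoʳ-≤ K (ℕ.*-monoʳ-≤ 1 (ℕ.≤-trans (ℕ.m≤m+n m _) (ℕ.m≤m+n _ 2))))
    where
    identity : ∀ m K → m ℕ.* (K ℕ.* 1) ≡ K ℕ.* (1 ℕ.* m)
    identity = solve-∀
  cnt-bound (suc e) m = ℕ.≤-trans (ℕ.+-monoʳ-≤ _ (cnt-bound e (suc m))) (ℕ.≤-reflexive (identity m K (2 ^ e)))
    where
    identity : ∀ m K q → m ℕ.* (K ℕ.* (2 ℕ.* q ℕ.* 1)) ℕ.+ K ℕ.* (q ℕ.* (2 ℕ.* suc m ℕ.+ 2))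
                       ≡ K ℕ.* (2 ℕ.* q ℕ.* (2 ℕ.* m ℕ.+ 2))
    identity = solve-∀

  module _ (8K+2≤n : 8 ℕ.* K ℕ.+ 2 ≤ n) where

    -- A cut for each side and the 2 ^ suc e pairs to keep need at most (8 K + 2) 2 ^ e of the n 2 ^
    -- e pairs; `d` is the surplus.
    enough : ∀ e → ∃ λ d → n ℕ.* 2 ^ e ≡ cnt e 1 ℕ.+ (cnt e 1 ℕ.+ (2 ^ suc e ℕ.+ d))
    enough e = let d , eq = ℕ.m≤n⇒∃[o]m+o≡n bound in d , ≡.trans (≡.sym eq) (assoc (cnt e 1) (2 ^ suc e) d)
      where
      assoc : ∀ a b d → a ℕ.+ (a ℕ.+ b) ℕ.+ d ≡ a ℕ.+ (a ℕ.+ (b ℕ.+ d))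
      assoc = solve-∀
      identity : ∀ K q → K ℕ.* (q ℕ.* 4) ℕ.+ (K ℕ.* (q ℕ.* 4) ℕ.+ 2 ℕ.* q) ≡ (8 ℕ.* K ℕ.+ 2) ℕ.* q
      identity = solve-∀
      bound : cnt e 1 ℕ.+ (cnt e 1 ℕ.+ 2 ^ suc e) ≤ n ℕ.* 2 ^ e
      bound = ℕ.≤-trans (ℕ.+-mono-≤ (cnt-bound e 1) (ℕ.+-monoˡ-≤ _ (cnt-bound e 1)))
        (ℕ.≤-trans (ℕ.≤-reflexive (identity K (2 ^ e))) (ℕ.*-monoˡ-≤ (2 ^ e) 8K+2≤n))

    module _ (G H : Gates) where

      Good : ℕ → Set _
      Good e = Σ (Sys e (2 ^ e)) λ S → Stage G e S × Stage H e (swap S)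

      -- Extend, cut the α side for `G`, swap, cut the other side for `H`, then swap back and
      -- discard the surplus. All spans only shrink, so the first condition survives the second cut.
      good-suc : ∀ {e} → Good e → ¬ ¬ Good (suc e)
      good-suc {e} (S , stG , stH) =
        ¬¬-bind (cut-next stG X (slices (α S) (proj₁ X⊑))) λ (S₁ , S₁⊑X , S₁⊥) →
        let S₁⊑ = ⊑-trans {S = S₁} {X} {ext S} S₁⊑X X⊑ in
        ¬¬-map (λ (S₂ , S₂⊑S₁ , S₂⊥) →
          let S₃ , S₃⊑S₂ = restrict (swap S₂) (_↑ˡ d) (δ-↑ˡ d)
              S₃⊑S₁ = ⊑-trans {S = S₃} {swap S₂} {S₁} S₃⊑S₂ (proj₂ S₂⊑S₁ , proj₁ S₂⊑S₁)
              S₃⊑ = ⊑-trans {S = S₃} {S₁} {ext S} S₃⊑S₁ S₁⊑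
          in S₃
           , next stG S₃ (proj₁ S₃⊑) (λ a → Span⊆ (KillsUpTo-subspace G e (suc e)) S₁⊥ (proj₁ S₃⊑S₁ a))
           , next stH (swap S₃) (proj₂ S₃⊑) (λ a → Span⊆ (KillsUpTo-subspace H e (suc e)) S₂⊥ (proj₂ S₃⊑S₂ a)))
        (cut-next stH (swap S₁) (slices (β S) (proj₂ S₁⊑)))
        where
        d : ℕ
        d = proj₁ (enough e)
        resized : Σ (Sys (suc e) (cnt e 1 ℕ.+ (cnt e 1 ℕ.+ (2 ^ suc e ℕ.+ d)))) (_⊑ ext S)
        resized = resize (proj₂ (enough e)) (ext S)
        X = proj₁ resized
        X⊑ = proj₂ resized
        slices : ∀ {r r′} (γ : Fin r → Fun) {ε : Fin r′ → Fun} → (∀ a → Span (extα γ) (ε a)) →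
                 ∀ a → Slices (Span γ) 1 (ε a)
        slices γ ε⊑ a (j ∷ []) _ =
          Span⊆ (preimage-subspace {U = Span γ} (j ∷_) (Span-subspace γ)) (λ b → extα-slice γ b j) (ε⊑ a)

      good : ∀ e → ¬ ¬ Good e
      good zero    k = k (S₀ , stage₀ G S₀ , stage₀ H (swap S₀))
      good (suc e) = ¬¬-bind (good e) good-suc

      ∃-killing-pair : ¬ ¬ (Σ Fun λ T → Σ Fun λ R →
                       -- Any of the 2 ^ n dual pairs at level `n` serves.
                       AllKills G n T × AllKills H n R × ⟨ T , R ⟩[ n ] ≈ 1#)
      ∃-killing-pair = ¬¬-map (λ (S , stG , stH) → let i = first n in
          α S i , β S i , kills stG i , kills stH i , trans (dual S i i) (reflexive (δ-refl i)))
        (good n)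
        where
        first : ∀ e → Fin (2 ^ e)
        first zero    = zero
        first (suc e) = first e ↑ˡ (2 ^ e ℕ.+ 0)

-- Factors of product gates.

module Factors {c ℓ} (F : Field c ℓ) (n : ℕ) where
  open Poly F n
  open Circ F n

  leftInput rightInput : ∀ {k} → (Fin k → Pol) → Vertex k → Pol
  leftInput ρ (timesGate a l b r) = scaleP a (ρ l)
  -- Other vertices get 0, whose kill condition is trivial, so that chunks can be formed by vertex
  -- number alone.
  leftInput ρ _                   = 0P
  rightInput ρ (timesGate a l b r) = scaleP b (ρ r)
  rightInput ρ _                   = 0P

  leftFactor rightFactor : ∀ {s} → Circuit s → Fin s → Pol
  leftFactor (C ▷ v) zero    = leftInput (eval C) v
  leftFactor (C ▷ v) (suc i) = leftFactor C i
  rightFactor (C ▷ v) zero    = rightInput (eval C) v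
  rightFactor (C ▷ v) (suc i) = rightFactor C i

-- Contracting the polynomials of a circuit with `T` and `R`.

module Contraction {c ℓ} (F : Field c ℓ) (n : ℕ) (T R : List (Fin n) → Field.Carrier F) where
  open Field F hiding (zero; _≉_)
  open Poly F n
  open Circ F n
  open WordSums F n
  open Factors F n
  open import Relation.Binary.Reasoning.Setoid setoid
  open import Algebra.Solver.Ring.NaturalCoefficients.Default commutativeSemiring

  X Y : Wd → Word n
  X = map xv
  Y = map yv

  *P-[] : ∀ f g → (f *P g) [] ≈ f [] * g []
  *P-[] f g = +-identityʳ _

  foldr-map≡ : ∀ {a b d} {A : Set a} {B : Set b} {D : Set d} {h : A → B} {k : B → D → D} {k′ : A → D → D} {e} →
               (∀ p acc → k (h p) acc ≡ k′ p acc) → ∀ xs → foldr k e (map h xs) ≡ foldr k′ e xs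
  foldr-map≡ eq []       = ≡.refl
  foldr-map≡ {h = h} {k} {k′} eq (x ∷ xs) =
    ≡.trans (eq x _) (≡.cong (k′ x) (foldr-map≡ {h = h} {k} {k′} eq xs))

  *P-∷ : ∀ f g a w → (f *P g) (a ∷ w) ≡ f [] * g (a ∷ w) + ((f ∘ (a ∷_)) *P g) w
  *P-∷ f g a w = ≡.cong (f [] * g (a ∷ w) +_) (foldr-map≡ (λ _ _ → ≡.refl) (splits w))

  -- Only cuts with a nonempty right part are summed, so that in `*P-X` the cut between the x-part
  -- and the y-part is counted once, with the latter.
  cutSum : (Wd → Wd → Carrier) → Wd → Carrier
  cutSum φ []      = 0#
  cutSum φ (i ∷ u) = φ [] (i ∷ u) + cutSum (λ v → φ (i ∷ v)) u

  *P-X : ∀ f g u y → (f *P g) (X u ++ y) ≈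
         cutSum (λ v v′ → f (X v) * g (X v′ ++ y)) u + ((λ y′ → f (X u ++ y′)) *P g) y
  *P-X f g []      y = sym (+-identityˡ _)
  *P-X f g (i ∷ u) y = trans (reflexive (*P-∷ f g _ _))
    (trans (+-congˡ (*P-X (f ∘ (xv i ∷_)) g u y)) (sym (+-assoc _ _ _)))

  *P-Y : ∀ f g u → (f *P g) (Y u) ≈ cutSum (λ v v′ → f (Y v) * g (Y v′)) u + f (Y u) * g []
  *P-Y f g []      = trans (*P-[] f g) (sym (+-identityˡ _))
  *P-Y f g (i ∷ u) = trans (reflexive (*P-∷ f g _ _))
    (trans (+-congˡ (*P-Y (f ∘ (yv i ∷_)) g u)) (sym (+-assoc _ _ _)))

  cutSum-*ʳ : ∀ φ (ω : Fun) u → cutSum φ u * ω u ≈ cutSum (λ v v′ → φ v v′ * ω (v ++ v′)) u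
  cutSum-*ʳ φ ω []      = zeroˡ _
  cutSum-*ʳ φ ω (i ∷ u) = trans (distribʳ _ _ _) (+-congˡ (cutSum-*ʳ (λ v → φ (i ∷ v)) (ω ∘ (i ∷_)) u))

  sum-cutSum : ∀ {m} (φ : Fin m → Wd → Wd → Carrier) u →
               sum (λ i → cutSum (φ i) u) ≈ cutSum (λ v v′ → sum λ i → φ i v v′) u
  sum-cutSum φ []      = sum-zero λ _ → refl
  sum-cutSum φ (i ∷ u) = trans (sum-+ _ _) (+-congˡ (sum-cutSum (λ j v → φ j (i ∷ v)) u))

  sumW-cutSum : ∀ m (φ : Wd → Wd → Wd → Carrier) u →
                sumW m (λ w → cutSum (φ w) u) ≈ cutSum (λ v v′ → sumW m λ w → φ w v v′) u
  sumW-cutSum m φ []      = sumW-zero m λ _ → refl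
  sumW-cutSum m φ (i ∷ u) = trans (sumW-+ m _ _) (+-congˡ (sumW-cutSum m (λ w v → φ w (i ∷ v)) u))

  -- A word with a cut is a pair of words, so the sum regroups by the lengths of the two pieces.
  sumW-cutSum-zero : ∀ m (φ : Wd → Wd → Carrier) →
    (∀ k j → k ℕ.+ suc j ≡ m → sumW k (λ v → sumW (suc j) (φ v)) ≈ 0#) → sumW m (cutSum φ) ≈ 0#
  sumW-cutSum-zero zero    φ φ≈0 = refl
  sumW-cutSum-zero (suc m) φ φ≈0 = begin
    sum (λ i → sumW m (λ u → φ [] (i ∷ u) + cutSum (λ v → φ (i ∷ v)) u))
      ≈⟨ (sum-cong λ i → sumW-+ m _ _) ⟩
    sum (λ i → sumW m (λ u → φ [] (i ∷ u)) + sumW m (cutSum (λ v → φ (i ∷ v))))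
      ≈⟨ sum-+ _ _ ⟩
    sumW (suc m) (φ []) + sum (λ i → sumW m (cutSum (λ v → φ (i ∷ v))))
      ≈⟨ +-cong (φ≈0 0 m ≡.refl) (sym (sumW-sum m _)) ⟩
    0# + sumW m (λ u → sum (λ i → cutSum (λ v → φ (i ∷ v)) u))
      ≈⟨ +-identityˡ _ ⟩
    sumW m (λ u → sum (λ i → cutSum (λ v → φ (i ∷ v)) u))
      ≈⟨ (sumW-cong m λ u → sum-cutSum (λ i v → φ (i ∷ v)) u) ⟩
    sumW m (cutSum (λ v v′ → sum λ i → φ (i ∷ v) v′))
      ≈⟨ sumW-cutSum-zero m _ (λ k j eq → begin
           sumW k (λ v → sumW (suc j) (λ v′ → sum λ i → φ (i ∷ v) v′))   ≈⟨ (sumW-cong k λ v → sumW-sum (suc j) (λ i → φ (i ∷ v))) ⟩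
           sumW k (λ v → sum λ i → sumW (suc j) (φ (i ∷ v)))             ≈⟨ sumW-sum k _ ⟩
           sumW (suc k) (λ v → sumW (suc j) (φ v))                       ≈⟨ φ≈0 (suc k) j (≡.cong suc eq) ⟩
           0# ∎) ⟩
    0# ∎

  -- Arguments of T and R list the indices innermost first, so u is reversed and v is not.
  weight : Wd → Wd → Wd → Wd → Carrier
  weight w w′ u v = T (reverse u ++ w) * R (v ++ w′)

  -- `w` and `w′` fix the indices at the positions below those summed over.
  Φ : ℕ → ℕ → Wd → Wd → Pol → Carrier
  Φ a b w w′ f = sumW a λ u → sumW b λ v → f (X u ++ Y v) * weight w w′ u v

  Φ-cong : ∀ a b w w′ {f g} → f ≋ g → Φ a b w w′ f ≈ Φ a b w w′ g
  Φ-cong a b w w′ eq = sumW-cong a λ u → sumW-cong b λ v → *-congʳ (eq _)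

  Φ-+ : ∀ a b w w′ f g → Φ a b w w′ (f +P g) ≈ Φ a b w w′ f + Φ a b w w′ g
  Φ-+ a b w w′ f g = trans
    (sumW-cong a λ u → trans (sumW-cong b λ v → distribʳ _ _ _) (sumW-+ b _ _)) (sumW-+ a _ _)

  Φ-scale : ∀ a b w w′ k f → Φ a b w w′ (scaleP k f) ≈ k * Φ a b w w′ f
  Φ-scale a b w w′ k f = trans
    (sumW-cong a λ u → trans (sumW-cong b λ v → *-assoc _ _ _) (sumW-*ˡ b k _)) (sumW-*ˡ a k _)

  Φ-zero : ∀ a b w w′ {f} → (∀ u v → length u ≡ a → length v ≡ b → f (X u ++ Y v) ≈ 0#) → Φ a b w w′ f ≈ 0#
  Φ-zero a b w w′ f≈0 = sumW-zero′ a λ u |u| → sumW-zero′ b λ v |v| → trans (*-congʳ (f≈0 u v |u| |v|)) (zeroˡ _)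

  -- A product cuts `X u ++ Y v` before the end of the x-part, from there to before the end of the
  -- y-part, or at the very end. The last case contributes `h []` times the contraction of `g`.
  Φ-*P-zero : ∀ a b w w′ g h →
    (∀ k j → k ℕ.+ suc j ≡ a →
      sumW k (λ u → sumW (suc j) λ u′ → sumW b λ v → g (X u) * h (X u′ ++ Y v) * weight w w′ (u ++ u′) v) ≈ 0#) →
    (∀ k j → k ℕ.+ suc j ≡ b →
      sumW k (λ v → sumW (suc j) λ v′ → sumW a λ u → g (X u ++ Y v) * h (Y v′) * weight w w′ u (v ++ v′)) ≈ 0#) →
    Φ a b w w′ g ≈ 0# → Φ a b w w′ (g *P h) ≈ 0#
  Φ-*P-zero a b w w′ g h cutX cutY Φg≈0 = begin
    Φ a b w w′ (g *P h)
      ≈⟨ (sumW-cong a λ u → sumW-cong b λ v → split u v) ⟩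
    sumW a (λ u → sumW b λ v → inX v u + (inY u v + atEnd u v))
      ≈⟨ (sumW-cong a λ u → trans (sumW-+ b _ _) (+-congˡ (sumW-+ b _ _))) ⟩
    sumW a (λ u → sumW b (λ v → inX v u) + (sumW b (inY u) + sumW b (atEnd u)))
      ≈⟨ trans (sumW-+ a _ _) (+-congˡ (sumW-+ a _ _)) ⟩
    sumW a (λ u → sumW b λ v → inX v u) + (sumW a (λ u → sumW b (inY u)) + sumW a (λ u → sumW b (atEnd u)))
      ≈⟨ +-cong inX≈0 (+-cong inY≈0 atEnd≈0) ⟩
    0# + (0# + 0#)
      ≈⟨ trans (+-identityˡ _) (+-identityˡ _) ⟩
    0# ∎
    where
    inX inY atEnd : Wd → Wd → Carrier
    inX v = cutSum λ u u′ → g (X u) * h (X u′ ++ Y v) * weight w w′ (u ++ u′) v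
    inY u = cutSum λ v v′ → g (X u ++ Y v) * h (Y v′) * weight w w′ u (v ++ v′)
    atEnd u v = g (X u ++ Y v) * h [] * weight w w′ u v

    split : ∀ u v → (g *P h) (X u ++ Y v) * weight w w′ u v ≈ inX v u + (inY u v + atEnd u v)
    split u v = trans (*-congʳ (trans (*P-X g h u (Y v)) (+-congˡ (*P-Y _ h v))))
      (trans (distribʳ _ _ _) (+-cong (cutSum-*ʳ _ (λ u → weight w w′ u v) u)
        (trans (distribʳ _ _ _) (+-congʳ (cutSum-*ʳ _ (weight w w′ u) v)))))

    inX≈0 : sumW a (λ u → sumW b λ v → inX v u) ≈ 0#
    inX≈0 = trans (sumW-cong a λ u → sumW-cutSum b (λ v u u′ → g (X u) * h (X u′ ++ Y v) * weight w w′ (u ++ u′) v) u)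
      (sumW-cutSum-zero a _ cutX)

    inY≈0 : sumW a (λ u → sumW b (inY u)) ≈ 0#
    inY≈0 = trans (sumW-comm a b inY)
      (trans (sumW-cong b λ v → sumW-cutSum a (λ u v v′ → g (X u ++ Y v) * h (Y v′) * weight w w′ u (v ++ v′)) v)
        (sumW-cutSum-zero b _ cutY))

    atEnd≈0 : sumW a (λ u → sumW b (atEnd u)) ≈ 0#
    atEnd≈0 = begin
      sumW a (λ u → sumW b (atEnd u))
        ≈⟨ (sumW-cong a λ u → trans (sumW-cong b λ v →
             solve 3 (λ p q r → p :* q :* r := q :* (p :* r)) refl (g (X u ++ Y v)) (h []) (weight w w′ u v)) (sumW-*ˡ b _ _)) ⟩
      sumW a (λ u → h [] * sumW b (λ v → g (X u ++ Y v) * weight w w′ u v))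
        ≈⟨ sumW-*ˡ a _ _ ⟩
      h [] * Φ a b w w′ g
        ≈⟨ trans (*-congˡ Φg≈0) (zeroʳ _) ⟩
      0# ∎

  -- The first two are `AllKills` for one factor: `z` fixes the positions above (p , p + k] and `w`
  -- those below.
  KillsLeft KillsRight Vanishes : ℕ → Pol → Set ℓ
  KillsLeft t g = ∀ p k z w → length z ℕ.+ (p ℕ.+ k) ≡ n → p ≤ t → t < p ℕ.+ k →
                  sumW k (λ u → g (X (reverse u)) * T (z ++ (u ++ w))) ≈ 0#
  KillsRight t h = ∀ p k z w → length z ℕ.+ (p ℕ.+ k) ≡ n → p ≤ t → t < p ℕ.+ k →
                   sumW k (λ u → h (Y u) * R (z ++ (u ++ w))) ≈ 0#
  Vanishes t f = ∀ p q a b w w′ → p ≤ t → q ≤ t → p ℕ.+ a ≡ n → q ℕ.+ b ≡ n → Φ a b w w′ f ≈ 0#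

  vanishes-≤ : ∀ {t t′ f} → t ≤ t′ → Vanishes t′ f → Vanishes t f
  vanishes-≤ t≤t′ f0 p q a b w w′ p≤t q≤t = f0 p q a b w w′ (ℕ.≤-trans p≤t t≤t′) (ℕ.≤-trans q≤t t≤t′)

  vanishes-scale : ∀ {t} k {f} → Vanishes t f → Vanishes t (scaleP k f)
  vanishes-scale k {f} f0 p q a b w w′ p≤t q≤t ea eb =
    trans (Φ-scale a b w w′ k f) (trans (*-congˡ (f0 p q a b w w′ p≤t q≤t ea eb)) (zeroʳ k))

  vanishes-+P : ∀ {t f g} → Vanishes t f → Vanishes t g → Vanishes t (f +P g)
  vanishes-+P {t} {f} {g} f0 g0 p q a b w w′ p≤t q≤t ea eb = trans (Φ-+ a b w w′ f g)
    (trans (+-cong (f0 p q a b w w′ p≤t q≤t ea eb) (g0 p q a b w w′ p≤t q≤t ea eb)) (+-identityˡ 0#))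

  reverse-++-++ : ∀ (u u′ w : Wd) → reverse (u ++ u′) ++ w ≡ reverse u′ ++ (reverse u ++ w)
  reverse-++-++ u u′ w = ≡.trans (≡.cong (_++ w) (List.reverse-++ u u′)) (List.++-assoc (reverse u′) (reverse u) w)

  vanishes-*P : ∀ {t g h} → KillsLeft t g → KillsRight t h → Vanishes t g → Vanishes t h → Vanishes t (g *P h)
  vanishes-*P {t} {g} {h} kl kr g0 h0 p q a b w w′ p≤t q≤t ea eb =
    Φ-*P-zero a b w w′ g h (λ k j → cutX k (suc j)) (λ k j → cutY k (suc j)) (g0 p q a b w w′ p≤t q≤t ea eb)
    where
    cutX : ∀ k m → k ℕ.+ m ≡ a →
      sumW k (λ u → sumW m λ u′ → sumW b λ v → g (X u) * h (X u′ ++ Y v) * weight w w′ (u ++ u′) v) ≈ 0#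
    cutX k m ≡.refl with ℕ.≤-<-connex (p ℕ.+ k) t
    -- The letters of `u` join the fixed ones, and `h` is contracted from positions `p + k` and `q`,
    -- both at most `t`.
    ... | inj₁ p+k≤t = sumW-zero k λ u → begin
      sumW m (λ u′ → sumW b λ v → g (X u) * h (X u′ ++ Y v) * weight w w′ (u ++ u′) v)
        ≈⟨ (sumW-cong m λ u′ → trans (sumW-cong b λ v →
             trans (*-assoc _ _ _) (*-congˡ (*-congˡ (*-congʳ (reflexive (≡.cong T (reverse-++-++ u u′ w)))))))
             (sumW-*ˡ b _ _)) ⟩
      sumW m (λ u′ → g (X u) * sumW b (λ v → h (X u′ ++ Y v) * weight (reverse u ++ w) w′ u′ v))
        ≈⟨ sumW-*ˡ m _ _ ⟩
      g (X u) * Φ m b (reverse u ++ w) w′ h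
        ≈⟨ *-congˡ (h0 (p ℕ.+ k) q m b (reverse u ++ w) w′ p+k≤t q≤t (≡.trans (ℕ.+-assoc p k m) ea) eb) ⟩
      g (X u) * 0#
        ≈⟨ zeroʳ _ ⟩
      0# ∎
    -- Here p ≤ t < p + k, so for fixed `u′` and `v` the sum over `u` contracts `T` with `g` along
    -- (p , p + k].
    ... | inj₂ t<p+k = trans (sumW-comm k m _) (sumW-zero′ m λ u′ |u′| →
        trans (sumW-comm k b _) (sumW-zero b λ v → begin
      sumW k (λ u → g (X u) * h (X u′ ++ Y v) * weight w w′ (u ++ u′) v)
        ≈⟨ (sumW-cong k λ u → trans (*-congˡ (*-congʳ (reflexive (≡.cong T (reverse-++-++ u u′ w)))))
             (trans (solve 4 (λ p q r s → p :* q :* (r :* s) := p :* r :* (q :* s)) refl _ _ _ _)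
               (*-congʳ (*-congʳ (reflexive (≡.cong (g ∘ X) (≡.sym (List.reverse-involutive u)))))))) ⟩
      sumW k (λ u → g (X (reverse (reverse u))) * T (reverse u′ ++ (reverse u ++ w)) * (h (X u′ ++ Y v) * R (v ++ w′)))
        ≈⟨ sumW-*ʳ k _ _ ⟩
      sumW k (λ u → g (X (reverse (reverse u))) * T (reverse u′ ++ (reverse u ++ w))) * (h (X u′ ++ Y v) * R (v ++ w′))
        ≈⟨ *-congʳ (trans (sumW-reverse k (λ u → g (X (reverse u)) * T (reverse u′ ++ (u ++ w))))
             (kl p k (reverse u′) w (lengths u′ |u′|) p≤t t<p+k)) ⟩
      0# * (h (X u′ ++ Y v) * R (v ++ w′))
        ≈⟨ zeroˡ _ ⟩
      0# ∎))
      where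
      lengths : ∀ u′ → length u′ ≡ m → length (reverse u′) ℕ.+ (p ℕ.+ k) ≡ n
      lengths u′ |u′| = ≡.trans (≡.cong (ℕ._+ (p ℕ.+ k)) (≡.trans (List.length-reverse u′) |u′|))
        (≡.trans (ℕ.+-comm m (p ℕ.+ k)) (≡.trans (ℕ.+-assoc p k m) ea))

    cutY : ∀ k m → k ℕ.+ m ≡ b →
      sumW k (λ v → sumW m λ v′ → sumW a λ u → g (X u ++ Y v) * h (Y v′) * weight w w′ u (v ++ v′)) ≈ 0#
    cutY k m ≡.refl with ℕ.≤-<-connex (q ℕ.+ m) t
    -- The y-word descends, so `v′` covers (q , q + m] and joins the fixed letters, while `g` is
    -- contracted from `p` and `q + m`.
    ... | inj₁ q+j≤t = trans (sumW-comm k m _) (sumW-zero m λ v′ → begin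
      sumW k (λ v → sumW a λ u → g (X u ++ Y v) * h (Y v′) * weight w w′ u (v ++ v′))
        ≈⟨ sumW-comm k a _ ⟩
      sumW a (λ u → sumW k λ v → g (X u ++ Y v) * h (Y v′) * weight w w′ u (v ++ v′))
        ≈⟨ (sumW-cong a λ u → trans (sumW-cong k λ v → trans
             (*-congˡ (*-congˡ (reflexive (≡.cong R (List.++-assoc v v′ w′)))))
             (solve 3 (λ p q r → p :* q :* r := q :* (p :* r)) refl _ _ _)) (sumW-*ˡ k _ _)) ⟩
      sumW a (λ u → h (Y v′) * sumW k (λ v → g (X u ++ Y v) * weight w (v′ ++ w′) u v))
        ≈⟨ sumW-*ˡ a _ _ ⟩
      h (Y v′) * Φ a k w (v′ ++ w′) g
        ≈⟨ *-congˡ (g0 p (q ℕ.+ m) a k w (v′ ++ w′) p≤t q+j≤t ea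
             (≡.trans (ℕ.+-assoc q m k) (≡.trans (≡.cong (q ℕ.+_) (ℕ.+-comm m k)) eb))) ⟩
      h (Y v′) * 0#
        ≈⟨ zeroʳ _ ⟩
      0# ∎)
    ... | inj₂ t<q+j = sumW-zero′ k λ v |v| → trans (sumW-comm m a _) (sumW-zero a λ u → begin
      sumW m (λ v′ → g (X u ++ Y v) * h (Y v′) * weight w w′ u (v ++ v′))
        ≈⟨ (sumW-cong m λ v′ → trans
             (*-congˡ (*-congˡ (reflexive (≡.cong R (List.++-assoc v v′ w′)))))
             (solve 4 (λ p q r s → p :* q :* (r :* s) := q :* s :* (p :* r)) refl _ _ _ _)) ⟩
      sumW m (λ v′ → h (Y v′) * R (v ++ (v′ ++ w′)) * (g (X u ++ Y v) * T (reverse u ++ w)))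
        ≈⟨ sumW-*ʳ m _ _ ⟩
      sumW m (λ v′ → h (Y v′) * R (v ++ (v′ ++ w′))) * (g (X u ++ Y v) * T (reverse u ++ w))
        ≈⟨ *-congʳ (kr q m v w′ (lengths v |v|) q≤t t<q+j) ⟩
      0# * (g (X u ++ Y v) * T (reverse u ++ w))
        ≈⟨ zeroˡ _ ⟩
      0# ∎)
      where
      lengths : ∀ v → length v ≡ k → length v ℕ.+ (q ℕ.+ m) ≡ n
      lengths v ≡.refl = ≡.trans (ℕ.+-comm k (q ℕ.+ m)) (≡.trans (ℕ.+-assoc q m k)
        (≡.trans (≡.cong (q ℕ.+_) (ℕ.+-comm m k)) eb))

  constP-long : ∀ a {w} → 2 ≤ length w → constP a w ≡ 0#
  constP-long a {_ ∷ _} _ = ≡.refl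

  varP-long : ∀ v {w} → 2 ≤ length w → varP v w ≡ 0#
  varP-long v {_ ∷ []}    (s≤s ())
  varP-long v {_ ∷ _ ∷ _} _ = ≡.refl

  -- Since p , q ≤ t < n, every word involved has an x-letter and a y-letter and so lies outside the
  -- support of a leaf.
  vanishes-long : ∀ {t f} → t < n → (∀ {w} → 2 ≤ length w → f w ≡ 0#) → Vanishes t f
  vanishes-long {t} {f} t<n f≡0 p q a b w w′ p≤t q≤t ea eb = Φ-zero a b w w′ {f} λ where
      u v ≡.refl ≡.refl → reflexive (f≡0 (≡.subst (2 ≤_) (≡.sym (|XuYv| u v)) (ℕ.+-mono-≤ (positive p≤t ea) (positive q≤t eb))))
    where
    |XuYv| : ∀ u v → length (X u ++ Y v) ≡ length u ℕ.+ length v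
    |XuYv| u v = ≡.trans (List.length-++ (X u)) (≡.cong₂ ℕ._+_ (List.length-map xv u) (List.length-map yv v))
    positive : ∀ {p a} → p ≤ t → p ℕ.+ a ≡ n → 1 ≤ a
    positive {p} {zero}  p≤t ea = contradiction (≡.trans (≡.sym (ℕ.+-identityʳ p)) ea) (ℕ.<⇒≢ (ℕ.≤-<-trans p≤t t<n))
    positive {p} {suc a} _   _  = s≤s z≤n

  -- Index 0 is the last vertex, so inputs have larger indices and, by monotonicity, thresholds at
  -- least as large; `vanishes-≤` lowers these to the threshold of the gate.
  circuit-vanishes : ∀ {s} (C : Circuit s) (τ : Fin s → ℕ) →
    (∀ {i j} → toℕ i ≤ toℕ j → τ i ≤ τ j) → (∀ i → τ i < n) →
    (∀ i → KillsLeft (τ i) (leftFactor C i)) → (∀ i → KillsRight (τ i) (rightFactor C i)) →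
    ∀ i → Vanishes (τ i) (eval C i)
  circuit-vanishes (C ▷ v) τ mono τ<n kl kr = λ where
      zero    → gate v (kl zero) (kr zero)
      (suc i) → rest i
    where
    rest : ∀ i → Vanishes (τ (suc i)) (eval C i)
    rest = circuit-vanishes C (τ ∘ suc) (λ i≤j → mono (s≤s i≤j)) (τ<n ∘ suc) (kl ∘ suc) (kr ∘ suc)
    input : ∀ a i → Vanishes (τ zero) (scaleP a (eval C i))
    input a i = vanishes-scale a {eval C i} (vanishes-≤ {f = eval C i} (mono z≤n) (rest i))
    gate : ∀ v → KillsLeft (τ zero) (leftFactor (C ▷ v) zero) → KillsRight (τ zero) (rightFactor (C ▷ v) zero) →
           Vanishes (τ zero) (evalVertex (eval C) v)
    gate (leafConst a)       _ _ = vanishes-long {f = constP a} (τ<n zero) (λ {w} → constP-long a {w})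
    gate (leafVar x)         _ _ = vanishes-long {f = varP x} (τ<n zero) (λ {w} → varP-long x {w})
    gate (plusGate a l b r)  _ _ = vanishes-+P {f = scaleP a (eval C l)} {scaleP b (eval C r)} (input a l) (input b r)
    gate (timesGate a l b r) kl kr =
      vanishes-*P {g = scaleP a (eval C l)} {scaleP b (eval C r)} kl kr (input a l) (input b r)

  -- Contraction of the palindrome polynomial.

  varP-x : ∀ i j → varP (xv i) (xv j ∷ []) ≡ δ i j
  varP-x i j with i Fin.≟ j
  ... | yes ≡.refl = ≡.sym (δ-refl i)
  ... | no  i≢j    = ≡.sym (δ-≢ i≢j)

  varP-y : ∀ i j → varP (yv i) (yv j ∷ []) ≡ δ i j
  varP-y i j with i Fin.≟ j
  ... | yes ≡.refl = ≡.sym (δ-refl i)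
  ... | no  i≢j    = ≡.sym (δ-≢ i≢j)

  const-*P : ∀ f g w → (∀ a u → f (a ∷ u) ≈ 0#) → (f *P g) w ≈ f [] * g w
  const-*P f g []      f≈0 = *P-[] f g
  const-*P f g (a ∷ w) f≈0 = begin
    (f *P g) (a ∷ w)                             ≈⟨ reflexive (*P-∷ f g a w) ⟩
    f [] * g (a ∷ w) + ((f ∘ (a ∷_)) *P g) w     ≈⟨ +-congˡ (const-*P (f ∘ (a ∷_)) g w λ b u → f≈0 a (b ∷ u)) ⟩
    f [] * g (a ∷ w) + f (a ∷ []) * g w          ≈⟨ +-congˡ (trans (*-congʳ (f≈0 a [])) (zeroˡ _)) ⟩
    f [] * g (a ∷ w) + 0#                        ≈⟨ +-identityʳ _ ⟩
    f [] * g (a ∷ w)                             ∎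

  varP-*P : ∀ v g a w → (varP v *P g) (a ∷ w) ≈ varP v (a ∷ []) * g w
  varP-*P v g a w = begin
    (varP v *P g) (a ∷ w)                              ≈⟨ reflexive (*P-∷ (varP v) g a w) ⟩
    0# * g (a ∷ w) + ((varP v ∘ (a ∷_)) *P g) w        ≈⟨ +-cong (zeroˡ _) (const-*P (varP v ∘ (a ∷_)) g w λ _ _ → refl) ⟩
    0# + varP v (a ∷ []) * g w                         ≈⟨ +-identityˡ _ ⟩
    varP v (a ∷ []) * g w                              ∎

  -- Each variable contributes a `δ`, which collapses the sum to u = is. The trailing `Q` and `y`
  -- allow one use for the x-part and another for the y-part.
  sumW-monomial : (ι : Fin n → Var n) → (∀ i j → varP (ι i) (ι j ∷ []) ≡ δ i j) →
    ∀ (is : Wd) Q y (ω : Fun) → sumW (length is) (λ u → prodP (map (λ i → varP (ι i)) is ++ Q) (map ι u ++ y) * ω u) ≈ prodP Q y * ω is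
  sumW-monomial ι ι-δ []       Q y ω = refl
  sumW-monomial ι ι-δ (i ∷ is) Q y ω = begin
    sum (λ j → sumW (length is) λ u → (varP (ι i) *P P) (ι j ∷ (map ι u ++ y)) * ω (j ∷ u))
      ≈⟨ (sum-cong λ j → trans
           (sumW-cong (length is) λ u → trans
             (*-congʳ (trans (varP-*P (ι i) P (ι j) (map ι u ++ y)) (*-congʳ (reflexive (ι-δ i j)))))
             (*-assoc _ _ _))
           (sumW-*ˡ (length is) (δ i j) (λ u → P (map ι u ++ y) * ω (j ∷ u)))) ⟩
    sum (λ j → δ i j * sumW (length is) λ u → P (map ι u ++ y) * ω (j ∷ u))
      ≈⟨ sum-δ i _ ⟩
    sumW (length is) (λ u → P (map ι u ++ y) * ω (i ∷ u))
      ≈⟨ sumW-monomial ι ι-δ is Q y (ω ∘ (i ∷_)) ⟩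
    prodP Q y * ω (i ∷ is) ∎
    where
    P : Pol
    P = prodP (map (λ i → varP (ι i)) is ++ Q)

  palTerm : Wd → Pol
  palTerm is = prodP (map (λ i → varP (xv i)) is ++ map (λ i → varP (yv i)) (reverse is))

  Φ-palTerm : ∀ m is → length is ≡ m → Φ m m [] [] (palTerm is) ≈ weight [] [] is (reverse is)
  Φ-palTerm m is ≡.refl = begin
    Φ m m [] [] (palTerm is)
      ≈⟨ sumW-comm m m _ ⟩
    sumW m (λ v → sumW m λ u → palTerm is (X u ++ Y v) * weight [] [] u v)
      ≈⟨ (sumW-cong m λ v → sumW-monomial xv varP-x is _ (Y v) (λ u → weight [] [] u v)) ⟩
    sumW m (λ v → prodP yis (Y v) * weight [] [] is v)
      ≈⟨ (sumW-cong m λ v → *-congʳ (reflexive (≡.cong₂ prodP (≡.sym (List.++-identityʳ yis)) (≡.sym (List.++-identityʳ (Y v)))))) ⟩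
    sumW m (λ v → prodP (yis ++ []) (Y v ++ []) * weight [] [] is v)
      ≡⟨ ≡.cong (λ m → sumW m λ v → prodP (yis ++ []) (Y v ++ []) * weight [] [] is v) (List.length-reverse is) ⟨
    sumW (length (reverse is)) (λ v → prodP (yis ++ []) (Y v ++ []) * weight [] [] is v)
      ≈⟨ sumW-monomial yv varP-y (reverse is) [] [] (weight [] [] is) ⟩
    1# * weight [] [] is (reverse is)
      ≈⟨ *-identityˡ _ ⟩
    weight [] [] is (reverse is) ∎
    where
    yis : List Pol
    yis = map (λ i → varP (yv i)) (reverse is)

  sumL : ∀ {a} {A : Set a} → (A → Carrier) → List A → Carrier
  sumL f = foldr (λ x acc → f x + acc) 0#

  sumL-cong : ∀ {a} {A : Set a} {f g : A → Carrier} → (∀ x → f x ≈ g x) → ∀ xs → sumL f xs ≈ sumL g xs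
  sumL-cong eq []       = refl
  sumL-cong eq (x ∷ xs) = +-cong (eq x) (sumL-cong eq xs)

  sumL-++ : ∀ {a} {A : Set a} (f : A → Carrier) xs ys → sumL f (xs ++ ys) ≈ sumL f xs + sumL f ys
  sumL-++ f []       ys = sym (+-identityˡ _)
  sumL-++ f (x ∷ xs) ys = trans (+-congˡ (sumL-++ f xs ys)) (sym (+-assoc _ _ _))

  sumL-concatMap : ∀ {a b} {A : Set a} {B : Set b} (f : B → Carrier) (g : A → List B) xs →
                   sumL f (concatMap g xs) ≈ sumL (λ x → sumL f (g x)) xs
  sumL-concatMap f g []       = refl
  sumL-concatMap f g (x ∷ xs) = trans (sumL-++ f (g x) (concatMap g xs)) (+-congˡ (sumL-concatMap f g xs))

  sumL-map : ∀ {a b} {A : Set a} {B : Set b} (f : B → Carrier) (g : A → B) xs → sumL f (map g xs) ≈ sumL (f ∘ g) xs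
  sumL-map f g []       = refl
  sumL-map f g (x ∷ xs) = +-congˡ (sumL-map f g xs)

  sumL-tabulate : ∀ {a m} {A : Set a} (f : A → Carrier) (g : Fin m → A) → sumL f (tabulate g) ≈ sum (f ∘ g)
  sumL-tabulate {m = zero}  f g = reflexive (≡.sym (sum-[] _))
  sumL-tabulate {m = suc m} f g = trans (+-congˡ (sumL-tabulate f (g ∘ suc))) (reflexive (≡.sym (sum-∷ _)))

  sumL-tuples : ∀ k (φ : Fun) → sumL (φ ∘ Vec.toList) (tuples k) ≈ sumW k φ
  sumL-tuples zero    φ = +-identityʳ _
  sumL-tuples (suc k) φ = begin
    sumL (φ ∘ Vec.toList) (tuples (suc k))
      ≈⟨ sumL-concatMap (φ ∘ Vec.toList) (λ i → map (i ∷_) (tuples k)) (allFin n) ⟩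
    sumL (λ i → sumL (φ ∘ Vec.toList) (map (i ∷_) (tuples k))) (allFin n)
      ≈⟨ sumL-cong (λ i → trans (sumL-map (φ ∘ Vec.toList) (i ∷_) (tuples k)) (sumL-tuples k (φ ∘ (i ∷_)))) (allFin n) ⟩
    sumL (λ i → sumW k (φ ∘ (i ∷_))) (allFin n)
      ≈⟨ sumL-tabulate (λ i → sumW k (φ ∘ (i ∷_))) id ⟩
    sumW (suc k) φ ∎

  Φ-sumP : ∀ a b w w′ fs → Φ a b w w′ (sumP fs) ≈ sumL (Φ a b w w′) fs
  Φ-sumP a b w w′ []       = Φ-zero a b w w′ {0P} λ u v _ _ → 0P≈0 (X u ++ Y v)
    where
    0P≈0 : ∀ z → 0P z ≈ 0#
    0P≈0 []      = refl
    0P≈0 (_ ∷ _) = refl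
  Φ-sumP a b w w′ (f ∷ fs) = trans (Φ-+ a b w w′ f (sumP fs)) (+-congˡ (Φ-sumP a b w w′ fs))

  -- The y-word of a palindrome is the reversed x-word, so `T` and `R` are evaluated at the same
  -- word.
  Φ-Pal : Φ n n [] [] Pal ≈ sumW n (λ u → T u * R u)
  Φ-Pal = begin
    Φ n n [] [] Pal
      ≈⟨ Φ-sumP n n [] [] (map (palTerm ∘ Vec.toList) (tuples n)) ⟩
    sumL (Φ n n [] []) (map (palTerm ∘ Vec.toList) (tuples n))
      ≈⟨ sumL-map (Φ n n [] []) (palTerm ∘ Vec.toList) (tuples n) ⟩
    sumL (Φ n n [] [] ∘ palTerm ∘ Vec.toList) (tuples n)
      ≈⟨ sumL-cong (λ is → Φ-palTerm n (Vec.toList is) (Vec.length-toList is)) (tuples n) ⟩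
    sumL ((λ u → weight [] [] u (reverse u)) ∘ Vec.toList) (tuples n)
      ≈⟨ sumL-tuples n (λ u → weight [] [] u (reverse u)) ⟩
    sumW n ((λ u → T (u ++ []) * R (u ++ [])) ∘ reverse)
      ≈⟨ sumW-reverse n (λ u → T (u ++ []) * R (u ++ [])) ⟩
    sumW n (λ u → T (u ++ []) * R (u ++ []))
      ≈⟨ (sumW-cong n λ u → reflexive (≡.cong (λ z → T z * R z) (List.++-identityʳ u))) ⟩
    sumW n (λ u → T u * R u) ∎

-- Circuits with at most n K vertices.

module _ {c ℓ} (F : Field c ℓ) (n K : ℕ) .{{_ : ℕ.NonZero K}} (8K+2≤n : 8 ℕ.* K ℕ.+ 2 ≤ n) where
  open Field F using (Carrier; _≈_; _*_; 0#; 1#; 1≉0; sym; trans)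
  open Poly F n
  open Circ F n
  open WordSums F n using (Wd; Fun; sumW)
  open Factors F n
  open Tower F n K using (Gates; AllKills; ∃-killing-pair)

  module _ {s} (f : Fin s → Fun) where

    nth : ℕ → Fun
    nth m with m ℕ.<? s
    ... | yes m<s = f (fromℕ< m<s)
    -- Numbers past the last vertex give a trivial condition, so every chunk has exactly `K`
    -- entries.
    ... | no  _   = λ _ → 0#

    nth-toℕ : ∀ i → nth (toℕ i) ≡ f i
    nth-toℕ i with toℕ i ℕ.<? s
    ... | yes i<s = ≡.cong f (Fin.fromℕ<-toℕ i i<s)
    ... | no  i≮s = contradiction (Fin.toℕ<n i) i≮s

    -- Vertices are numbered from the last one added, so inputs of a gate never lie in
    -- a chunk with a smaller number.
    chunks : Gates
    chunks t k = nth (toℕ k ℕ.+ t ℕ.* K)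

    chunks-kill : ∀ x → AllKills chunks n x → ∀ i p k z w → length z ℕ.+ (p ℕ.+ k) ≡ n →
                  p ≤ toℕ i ℕ./ K → toℕ i ℕ./ K < p ℕ.+ k → sumW k (λ u → f i u * x (z ++ (u ++ w))) ≈ 0#
    chunks-kill x kills i p k z w |z| p≤t t<p+k = ≡.subst
      (λ g → sumW k (λ u → g u * x (z ++ (u ++ w))) ≈ 0#)
      (≡.trans (≡.cong nth index) (nth-toℕ i))
      (kills z (p ℕ.+ k) |z| p k (toℕ i ℕ./ K) (toℕ i ℕ.mod K) ≡.refl p≤t t<p+k w)
      where
      index : toℕ (toℕ i ℕ.mod K) ℕ.+ toℕ i ℕ./ K ℕ.* K ≡ toℕ i
      index = ≡.trans (≡.cong (ℕ._+ toℕ i ℕ./ K ℕ.* K) (Fin.toℕ-fromℕ< (ℕ.m%n<n (toℕ i) K)))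
        (≡.sym (ℕ.m≡m%n+[m/n]*n (toℕ i) K))

  no-small-circuit : ∀ {s} (C : Circuit s) → s ≤ n ℕ.* K → ¬ Computes C Pal
  no-small-circuit {s} C s≤nK (i , Ci≋Pal) =
    ∃-killing-pair 8K+2≤n (chunks lefts) (chunks rights) λ (T , R , T-kills , R-kills , ⟨T,R⟩≈1) →
    let open Contraction F n T R
        Pal-vanishes = circuit-vanishes C (λ j → toℕ j ℕ./ K) (ℕ./-monoˡ-≤ K)
          -- As s ≤ n K, every vertex lies in a chunk numbered below `n`.
          (λ j → ℕ.m<n*o⇒m/o<n (ℕ.<-≤-trans (Fin.toℕ<n j) s≤nK))
          (chunks-kill lefts T T-kills) (chunks-kill rights R R-kills)
          i 0 0 n n [] [] z≤n z≤n ≡.refl ≡.refl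
    in 1≉0 (trans (sym ⟨T,R⟩≈1) (trans (sym Φ-Pal)
         (trans (Φ-cong n n [] [] {Pal} (λ w → sym (Ci≋Pal w))) Pal-vanishes)))
    where
    lefts rights : Fin s → Fun
    lefts  j u = leftFactor C j (map xv (reverse u))
    rights j u = rightFactor C j (map yv u)

-- Choice of constants.

open import Data.Nat using (_*_)

theorem12 : Σℕω λ k → Σℕω λ N →
    ∀ {c ℓ : Level} (F : Field c ℓ) (n : ℕ) → N ≤ n →
    ∀ {s} (C : Circ.Circuit F n s) → Circ.Computes F n C (Poly.Pal F n) →
    n * n ≤ suc k * s
-- n ≥ 16 makes K = n / 16 positive. Then 8 K + 2 ≤ 16 K ≤ n, and n < 16 K + 16 ≤ 32 K turns s > n K
-- into n n ≤ 32 s; the factor is `suc 31`.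
theorem12 = 31 ,ω (16 ,ω bound)
  where
  bound : ∀ {c ℓ} (F : Field c ℓ) n → 16 ≤ n → ∀ {s} (C : Circ.Circuit F n s) →
          Circ.Computes F n C (Poly.Pal F n) → n * n ≤ 32 * s
  bound F n 16≤n {s} C computes = [ few , many ]′ (ℕ.≤-<-connex s (n * K))
    where
    K : ℕ
    K = n ℕ./ 16

    1≤K : 1 ≤ K
    1≤K = ℕ./-monoˡ-≤ 16 16≤n

    8K+8K≡K*16 : ∀ K → 8 * K ℕ.+ 8 * K ≡ K * 16
    8K+8K≡K*16 = solve-∀

    K*16+K*16≡32K : ∀ K → K * 16 ℕ.+ K * 16 ≡ 32 * K
    K*16+K*16≡32K = solve-∀

    n*32K≡32*nK : ∀ n K → n * (32 * K) ≡ 32 * (n * K)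
    n*32K≡32*nK = solve-∀

    8K+2≤n : 8 * K ℕ.+ 2 ≤ n
    8K+2≤n = ℕ.≤-trans (ℕ.+-monoʳ-≤ (8 * K) (ℕ.≤-trans (ℕ.m≤m+n 2 6) (ℕ.*-monoʳ-≤ 8 1≤K)))
      (ℕ.≤-trans (ℕ.≤-reflexive (8K+8K≡K*16 K)) (ℕ.m/n*n≤m n 16))

    n≤32K : n ≤ 32 * K
    n≤32K = ℕ.≤-trans (ℕ.≤-reflexive (ℕ.m≡m%n+[m/n]*n n 16))
      (ℕ.≤-trans (ℕ.+-monoˡ-≤ (K * 16) (ℕ.≤-trans (ℕ.<⇒≤ (ℕ.m%n<n n 16)) (ℕ.*-monoˡ-≤ 16 1≤K)))
        (ℕ.≤-reflexive (K*16+K*16≡32K K)))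

    few : s ≤ n * K → n * n ≤ 32 * s
    few s≤nK = contradiction computes (no-small-circuit F n K {{ℕ.>-nonZero 1≤K}} 8K+2≤n C s≤nK)

    many : n * K < s → n * n ≤ 32 * s
    many nK<s = ℕ.≤-trans (ℕ.*-monoʳ-≤ n n≤32K)
      (ℕ.≤-trans (ℕ.≤-reflexive (n*32K≡32*nK n K)) (ℕ.*-monoʳ-≤ 32 (ℕ.<⇒≤ nK<s)))
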